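{- Fix an integer $\Delta\geq 2$. There exists $N$ (depending on $\Delta$) such that for every $2$-connected finite simple graph $G$ on $n\geq N$ vertices with maximum degree $\Delta$, the polynomial $\mathrm{nRel}(G;p)$ has at least two fixed points in $(0,1)$, i.e. at least two distinct $p\in(0,1)$ with $\mathrm{nRel}(G;p)=p$.
   Context: For a graph $G$ on $n$ vertices, a connected set is a nonempty vertex subset $C$ such that the induced subgraph $G[C]$ is connected. The node reliability of $G$ is the polynomial \[ \mathrm{nRel}(G;p)=\sum_{C}p^{|C|}(1-p)^{n-|C|}, \] the sum over all connected sets $C$ of $G$. -}

module Defs where

open import Algebra.Bundles.Raw using (RawRing)
import Algebra.Definitions.RawSemiring as RawSemiringDefs
open import Data.Bool using (true; false)
open import Data.Fin using (Fin)
import Data.Fin.Properties as Fin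
open import Data.Fin.Subset using (Subset; inside; outside; _∈_; ∁; ∣_∣; Nonempty)
open import Data.Fin.Subset.Properties using (_∈?_; nonempty?)
open import Data.List using (List; []; _∷_; _++_; map; filter; foldr; length; allFin)
open import Data.List.Extrema.Nat using (max)
open import Data.List.Membership.Propositional using () renaming (_∈_ to _∈ˡ_)
open import Data.List.Membership.Propositional.Properties using (∈-allFin)
open import Data.List.Relation.Unary.Any using (here; there)
open import Data.Nat using (ℕ; zero; suc; _∸_)
import Data.Nat as ℕ
import Data.Nat.Properties as ℕ
open import Data.Product using (_×_; _,_; ∃-syntax; proj₁; proj₂)
open import Data.Rational using (ℚ; 0ℚ; 1ℚ)
import Data.Rational as ℚ
import Data.Rational.Properties as ℚ
open import Data.Rational.Solver using (module +-*-Solver)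
open import Data.Sum using (_⊎_; inj₁; inj₂)
import Data.Vec as Vec
open import Level using (0ℓ)
open import Relation.Binary using (Rel; Decidable; Symmetric)
open import Relation.Binary.Construct.Closure.ReflexiveTransitive using (Star; ε; _◅_; _◅◅_)
open import Relation.Binary.PropositionalEquality using (_≡_; refl; sym; trans; cong; subst)
open import Relation.Nullary using (¬_; Dec)
open import Relation.Nullary.Decidable using (map′; _×-dec_; _⊎-dec_; _→-dec_)
import Relation.Unary as U

private
  variable
    n : ℕ

------------------------------------------------------------------------
-- Real numbers: Cauchy sequences of rationals, each carrying its modulus
-- of convergence, up to the equivalence _≈ℝ_.

IsCauchy : (ℕ → ℚ) → Set
IsCauchy s = ∀ δ → 0ℚ ℚ.< δ →
  ∃[ N ] (∀ i j → N ℕ.≤ i → N ℕ.≤ j → ℚ.∣ s i ℚ.- s j ∣ ℚ.< δ)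

record ℝ : Set where
  constructor mkℝ
  field
    seq    : ℕ → ℚ
    cauchy : IsCauchy seq

open ℝ public

infix 4 _≈ℝ_ _<ℝ_ _#ℝ_

_≈ℝ_ : Rel ℝ 0ℓ
x ≈ℝ y = ∀ δ → 0ℚ ℚ.< δ →
  ∃[ N ] (∀ i → N ℕ.≤ i → ℚ.∣ seq x i ℚ.- seq y i ∣ ℚ.< δ)

_<ℝ_ : Rel ℝ 0ℓ
x <ℝ y = ∃[ δ ] (0ℚ ℚ.< δ ×
  ∃[ N ] (∀ i → N ℕ.≤ i → seq x i ℚ.+ δ ℚ.≤ seq y i))

-- Apartness, the constructive form of x ≠ y; classically equivalent to
-- ¬ (x ≈ℝ y).
_#ℝ_ : Rel ℝ 0ℓ
x #ℝ y = x <ℝ y ⊎ y <ℝ x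

fromℚ : ℚ → ℝ
fromℚ q = mkℝ (λ _ → q) λ δ 0<δ → 0 , λ _ _ _ _ →
  subst (ℚ._< δ) (sym (cong ℚ.∣_∣ (ℚ.+-inverseʳ q))) 0<δ

0ℝ 1ℝ : ℝ
0ℝ = fromℚ 0ℚ
1ℝ = fromℚ 1ℚ

infix  8 -ℝ_
infixl 7 _*ℝ_
infixl 6 _+ℝ_

private
  pos-half : ∀ {δ} → 0ℚ ℚ.< δ → 0ℚ ℚ.< ℚ.½ ℚ.* δ
  pos-half {δ} 0<δ = subst (ℚ._< ℚ.½ ℚ.* δ) (ℚ.*-zeroʳ ℚ.½) (ℚ.*-monoʳ-<-pos ℚ.½ 0<δ)

  half+half : ∀ δ → ℚ.½ ℚ.* δ ℚ.+ ℚ.½ ℚ.* δ ≡ δ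
  half+half δ = trans (sym (ℚ.*-distribʳ-+ δ ℚ.½ ℚ.½)) (ℚ.*-identityˡ δ)

  max≤ˡ : ∀ {a b i} → a ℕ.⊔ b ℕ.≤ i → a ℕ.≤ i
  max≤ˡ {a} {b} = ℕ.≤-trans (ℕ.m≤m⊔n a b)

  max≤ʳ : ∀ {a b i} → a ℕ.⊔ b ℕ.≤ i → b ℕ.≤ i
  max≤ʳ {a} {b} = ℕ.≤-trans (ℕ.m≤n⊔m a b)

  sum-diff : ∀ a b c d → (a ℚ.+ b) ℚ.- (c ℚ.+ d) ≡ (a ℚ.- c) ℚ.+ (b ℚ.- d)
  sum-diff = solve 4 (λ a b c d → (a :+ b) :- (c :+ d) := (a :- c) :+ (b :- d)) refl
    where open +-*-Solver

  neg-diff : ∀ a b → (ℚ.- a) ℚ.- (ℚ.- b) ≡ ℚ.- (a ℚ.- b)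
  neg-diff = solve 2 (λ a b → (:- a) :- (:- b) := :- (a :- b)) refl
    where open +-*-Solver

  prod-diff : ∀ a b c d → a ℚ.* b ℚ.- c ℚ.* d ≡ a ℚ.* (b ℚ.- d) ℚ.+ d ℚ.* (a ℚ.- c)
  prod-diff = solve 4 (λ a b c d → a :* b :- c :* d := a :* (b :- d) :+ d :* (a :- c)) refl
    where open +-*-Solver

  add-sub : ∀ a b → a ≡ (a ℚ.- b) ℚ.+ b
  add-sub = solve 2 (λ a b → a := (a :- b) :+ b) refl
    where open +-*-Solver

_+ℝ_ : ℝ → ℝ → ℝ
x +ℝ y = mkℝ (λ i → seq x i ℚ.+ seq y i) c
  where
  open ℚ.≤-Reasoning
  c : IsCauchy (λ i → seq x i ℚ.+ seq y i)
  c δ 0<δ with cauchy x (ℚ.½ ℚ.* δ) (pos-half 0<δ) | cauchy y (ℚ.½ ℚ.* δ) (pos-half 0<δ)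
  ... | M , f | N , g = M ℕ.⊔ N , λ i j p q → begin-strict
    ℚ.∣ (seq x i ℚ.+ seq y i) ℚ.- (seq x j ℚ.+ seq y j) ∣
      ≡⟨ cong ℚ.∣_∣ (sum-diff (seq x i) (seq y i) (seq x j) (seq y j)) ⟩
    ℚ.∣ (seq x i ℚ.- seq x j) ℚ.+ (seq y i ℚ.- seq y j) ∣
      ≤⟨ ℚ.∣p+q∣≤∣p∣+∣q∣ (seq x i ℚ.- seq x j) (seq y i ℚ.- seq y j) ⟩
    ℚ.∣ seq x i ℚ.- seq x j ∣ ℚ.+ ℚ.∣ seq y i ℚ.- seq y j ∣
      <⟨ ℚ.+-mono-< (f i j (max≤ˡ {M} p) (max≤ˡ {M} q)) (g i j (max≤ʳ {M} p) (max≤ʳ {M} q)) ⟩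
    ℚ.½ ℚ.* δ ℚ.+ ℚ.½ ℚ.* δ
      ≡⟨ half+half δ ⟩
    δ ∎

-ℝ_ : ℝ → ℝ
-ℝ x = mkℝ (λ i → ℚ.- seq x i) λ δ 0<δ →
  let N , f = cauchy x δ 0<δ in
  N , λ i j p q → subst (ℚ._< δ)
    (sym (trans (cong ℚ.∣_∣ (neg-diff (seq x i) (seq x j))) (ℚ.∣-p∣≡∣p∣ (seq x i ℚ.- seq x j))))
    (f i j p q)

private
  bounded : (x : ℝ) → ∃[ B ] (0ℚ ℚ.< B × ∃[ N ] (∀ i → N ℕ.≤ i → ℚ.∣ seq x i ∣ ℚ.≤ B))
  bounded x with cauchy x 1ℚ (ℚ.positive⁻¹ 1ℚ)
  ... | N , f = 1ℚ ℚ.+ b , 0<B , N , λ i p → begin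
      ℚ.∣ seq x i ∣
        ≡⟨ cong ℚ.∣_∣ (add-sub (seq x i) (seq x N)) ⟩
      ℚ.∣ (seq x i ℚ.- seq x N) ℚ.+ seq x N ∣
        ≤⟨ ℚ.∣p+q∣≤∣p∣+∣q∣ (seq x i ℚ.- seq x N) (seq x N) ⟩
      ℚ.∣ seq x i ℚ.- seq x N ∣ ℚ.+ b
        ≤⟨ ℚ.+-monoˡ-≤ b (ℚ.<⇒≤ (f i N p ℕ.≤-refl)) ⟩
      1ℚ ℚ.+ b ∎
    where
    open ℚ.≤-Reasoning
    b = ℚ.∣ seq x N ∣
    0<B : 0ℚ ℚ.< 1ℚ ℚ.+ b
    0<B = ℚ.+-mono-<-≤ (ℚ.positive⁻¹ 1ℚ) (ℚ.0≤∣p∣ (seq x N))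

  divide : ∀ S δ → 0ℚ ℚ.< S → 0ℚ ℚ.< δ → ∃[ η ] (0ℚ ℚ.< η × S ℚ.* η ≡ δ)
  divide S δ 0<S 0<δ = S⁻¹ ℚ.* δ , 0<η , Sη≡δ
    where
    S≢0 : ℚ.NonZero S
    S≢0 = ℚ.pos⇒nonZero S {{ℚ.positive 0<S}}
    S⁻¹ : ℚ
    S⁻¹ = ℚ.1/_ S {{S≢0}}
    0<η : 0ℚ ℚ.< S⁻¹ ℚ.* δ
    0<η = subst (ℚ._< S⁻¹ ℚ.* δ) (ℚ.*-zeroʳ S⁻¹)
      (ℚ.*-monoʳ-<-pos S⁻¹ {{ℚ.1/pos⇒pos S {{ℚ.positive 0<S}}}} 0<δ)
    Sη≡δ : S ℚ.* (S⁻¹ ℚ.* δ) ≡ δ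
    Sη≡δ = trans (sym (ℚ.*-assoc S S⁻¹ δ))
      (trans (cong (ℚ._* δ) (ℚ.*-inverseʳ S {{S≢0}})) (ℚ.*-identityˡ δ))

  ∣*∣-bound : ∀ {C η} u v → 0ℚ ℚ.< C → ℚ.∣ u ∣ ℚ.≤ C → ℚ.∣ v ∣ ℚ.< η →
              ℚ.∣ u ℚ.* v ∣ ℚ.< C ℚ.* η
  ∣*∣-bound {C} {η} u v 0<C p q = begin-strict
    ℚ.∣ u ℚ.* v ∣          ≡⟨ ℚ.∣p*q∣≡∣p∣*∣q∣ u v ⟩
    ℚ.∣ u ∣ ℚ.* ℚ.∣ v ∣    ≤⟨ ℚ.*-monoʳ-≤-nonNeg ℚ.∣ v ∣ {{ℚ.∣-∣-nonNeg v}} p ⟩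
    C ℚ.* ℚ.∣ v ∣          <⟨ ℚ.*-monoʳ-<-pos C {{ℚ.positive 0<C}} q ⟩
    C ℚ.* η                ∎
    where open ℚ.≤-Reasoning

  ∣prod-diff∣-bound : ∀ {A B η} a b c d → 0ℚ ℚ.< A → 0ℚ ℚ.< B →
    ℚ.∣ a ∣ ℚ.≤ A → ℚ.∣ d ∣ ℚ.≤ B → ℚ.∣ a ℚ.- c ∣ ℚ.< η → ℚ.∣ b ℚ.- d ∣ ℚ.< η →
    ℚ.∣ a ℚ.* b ℚ.- c ℚ.* d ∣ ℚ.< (A ℚ.+ B) ℚ.* η
  ∣prod-diff∣-bound {A} {B} {η} a b c d 0<A 0<B a≤A d≤B a~c b~d = begin-strict
    ℚ.∣ a ℚ.* b ℚ.- c ℚ.* d ∣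
      ≡⟨ cong ℚ.∣_∣ (prod-diff a b c d) ⟩
    ℚ.∣ a ℚ.* (b ℚ.- d) ℚ.+ d ℚ.* (a ℚ.- c) ∣
      ≤⟨ ℚ.∣p+q∣≤∣p∣+∣q∣ (a ℚ.* (b ℚ.- d)) (d ℚ.* (a ℚ.- c)) ⟩
    ℚ.∣ a ℚ.* (b ℚ.- d) ∣ ℚ.+ ℚ.∣ d ℚ.* (a ℚ.- c) ∣
      <⟨ ℚ.+-mono-< (∣*∣-bound a (b ℚ.- d) 0<A a≤A b~d) (∣*∣-bound d (a ℚ.- c) 0<B d≤B a~c) ⟩
    A ℚ.* η ℚ.+ B ℚ.* η
      ≡⟨ sym (ℚ.*-distribʳ-+ η A B) ⟩
    (A ℚ.+ B) ℚ.* η ∎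
    where open ℚ.≤-Reasoning

_*ℝ_ : ℝ → ℝ → ℝ
x *ℝ y = mkℝ (λ i → seq x i ℚ.* seq y i) λ δ 0<δ →
  let A , 0<A , K , a = bounded x
      B , 0<B , L , b = bounded y
      η , 0<η , Sη≡δ  = divide (A ℚ.+ B) δ (ℚ.+-mono-< 0<A 0<B) 0<δ
      M , f           = cauchy x η 0<η
      N , g           = cauchy y η 0<η
  in (K ℕ.⊔ L) ℕ.⊔ (M ℕ.⊔ N) , λ i j p q →
     let KL≤j = max≤ˡ {K ℕ.⊔ L} q
         KL≤i = max≤ˡ {K ℕ.⊔ L} p
         MN≤i = max≤ʳ {K ℕ.⊔ L} p
         MN≤j = max≤ʳ {K ℕ.⊔ L} q
     in subst (_ ℚ.<_) Sη≡δ
       (∣prod-diff∣-bound (seq x i) (seq y i) (seq x j) (seq y j) 0<A 0<B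
         (a i (max≤ˡ {K} KL≤i)) (b j (max≤ʳ {K} KL≤j))
         (f i j (max≤ˡ {M} MN≤i) (max≤ˡ {M} MN≤j))
         (g i j (max≤ʳ {M} MN≤i) (max≤ʳ {M} MN≤j)))

ℝ-rawRing : RawRing 0ℓ 0ℓ
ℝ-rawRing = record
  { Carrier = ℝ
  ; _≈_     = _≈ℝ_
  ; _+_     = _+ℝ_
  ; _*_     = _*ℝ_
  ; -_      = -ℝ_
  ; 0#      = 0ℝ
  ; 1#      = 1ℝ
  }

------------------------------------------------------------------------
-- Finite simple graphs

record Graph (n : ℕ) : Set₁ where
  field
    Adj    : Rel (Fin n) 0ℓ
    Adj?   : Decidable Adj
    symm   : Symmetric Adj
    irrefl : ∀ {v} → ¬ Adj v v

open Graph public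

degree : Graph n → Fin n → ℕ
degree {n} G v = length (filter (Adj? G v) (allFin n))

-- The first argument of max is its value on the empty list.
maxDegree : Graph n → ℕ
maxDegree {n} G = max 0 (map (degree G) (allFin n))

InducedAdj : Graph n → Subset n → Rel (Fin n) 0ℓ
InducedAdj G C u v = u ∈ C × v ∈ C × Adj G u v

-- C is nonempty and any two of its vertices are joined by a walk inside C.
ConnectedSet : Graph n → Subset n → Set
ConnectedSet G C = Nonempty C × (∀ u v → u ∈ C → v ∈ C → Star (InducedAdj G C) u v)

KConnected : ℕ → Graph n → Set
KConnected {n} k G = k ℕ.< n × (∀ (X : Subset n) → ∣ X ∣ ℕ.< k → ConnectedSet G (∁ X))

-- Reachability in a finite relation is decidable (Floyd–Warshall):
-- Via xs u v says that v is reached from u through intermediate vertices in xs.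
private
  module Reachability {E : Rel (Fin n) 0ℓ} (E? : Decidable E) where

    Via : List (Fin n) → Rel (Fin n) 0ℓ
    Via []       u v = u ≡ v ⊎ E u v
    Via (x ∷ xs) u v = Via xs u v ⊎ (Via xs u x × Via xs x v)

    via? : ∀ xs → Decidable (Via xs)
    via? []       u v = (u Fin.≟ v) ⊎-dec E? u v
    via? (x ∷ xs) u v = via? xs u v ⊎-dec (via? xs u x ×-dec via? xs x v)

    sound : ∀ xs {u v} → Via xs u v → Star E u v
    sound []       (inj₁ refl)    = ε
    sound []       (inj₂ e)       = e ◅ ε
    sound (x ∷ xs) (inj₁ p)       = sound xs p
    sound (x ∷ xs) (inj₂ (p , q)) = sound xs p ◅◅ sound xs q

    base : ∀ xs {u v} → Via [] u v → Via xs u v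
    base []       p = p
    base (x ∷ xs) p = inj₁ (base xs p)

    compose : ∀ {xs m u v} → m ∈ˡ xs → Via xs u m → Via xs m v → Via xs u v
    compose (here refl) p q = inj₂ (to p , from q)
      where
      to : ∀ {x xs u} → Via (x ∷ xs) u x → Via xs u x
      to (inj₁ p)       = p
      to (inj₂ (p , _)) = p
      from : ∀ {x xs v} → Via (x ∷ xs) x v → Via xs x v
      from (inj₁ p)       = p
      from (inj₂ (_ , p)) = p
    compose (there m∈) (inj₁ p)       (inj₁ q)       = inj₁ (compose m∈ p q)
    compose (there m∈) (inj₁ p)       (inj₂ (q , r)) = inj₂ (compose m∈ p q , r)
    compose (there m∈) (inj₂ (p , q)) (inj₁ r)       = inj₂ (p , compose m∈ q r)
    compose (there m∈) (inj₂ (p , _)) (inj₂ (_ , r)) = inj₂ (p , r)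

    complete : ∀ {u v} → Star E u v → Via (allFin n) u v
    complete ε                       = base (allFin n) (inj₁ refl)
    complete (_◅_ {j = w} e p) =
      compose (∈-allFin w) (base (allFin n) (inj₂ e)) (complete p)

    star? : Decidable (Star E)
    star? u v = map′ (sound (allFin n)) complete (via? (allFin n) u v)

connectedSet? : (G : Graph n) → U.Decidable (ConnectedSet G)
connectedSet? G C = nonempty? C ×-dec
  Fin.all? λ u → Fin.all? λ v → (u ∈? C) →-dec ((v ∈? C) →-dec star? u v)
  where
  open Reachability {E = InducedAdj G C}
    (λ u v → (u ∈? C) ×-dec ((v ∈? C) ×-dec Adj? G u v))

------------------------------------------------------------------------
-- Node reliability

allSubsets : ∀ n → List (Subset n)
allSubsets zero    = Vec.[] ∷ []
allSubsets (suc n) =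
  map (outside Vec.∷_) (allSubsets n) ++ map (inside Vec.∷_) (allSubsets n)

connectedSets : Graph n → List (Subset n)
connectedSets {n} G = filter (connectedSet? G) (allSubsets n)

-- The integer polynomial nRel(G; p), evaluated at an element p of any ring.
module NodeReliability {c ℓ} (R : RawRing c ℓ) where
  open RawRing R
  open RawSemiringDefs rawSemiring using (_^_)

  nRel : Graph n → Carrier → Carrier
  nRel {n} G p = foldr _+_ 0#
    (map (λ C → p ^ ∣ C ∣ * (1# + - p) ^ (n ∸ ∣ C ∣)) (connectedSets G))

open NodeReliability ℝ-rawRing public using () renaming (nRel to nRelℝ)

InUnitInterval : ℝ → Set
InUnitInterval p = 0ℝ <ℝ p × p <ℝ 1ℝ

FixedPoint : Graph n → ℝ → Set
FixedPoint G p = nRelℝ G p ≈ℝ p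

{-# OPTIONS --safe #-}
-- For large n, nRel(G; p) lies above p near 0, below p at 1/2 and above p near
-- 1, and bisection finds a crossing on either side of 1/2.
--
-- Every singleton is connected, so nRel(G; p) ≥ np(1 - np). By 2-connectivity,
-- every set missing at most one vertex is connected, so
-- nRel(G; 1 - p) ≥ 1 - (np)². Both suffice once n²p < 1.
--
-- At p = 1/2, let K = 2^(Δ+1). Choose 4K vertices with pairwise disjoint closed
-- neighbourhoods, which exist since balls of radius 2 have at most (Δ+1)²
-- vertices. A random set isolates each of them with probability at least 1/K,
-- even when none of the earlier ones is isolated, so it isolates none of them
-- with probability at most 1/5. A connected set isolating v is {v}, so at most
-- 4K further sets are connected.
module Submission where

open import Defs
open import Algebra.Bundles using (module CommutativeRing)
open import Algebra.Bundles.Raw using (RawRing)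
import Algebra.Definitions.RawSemiring as RawSemiring
open import Algebra.Properties.Semiring.Mult using (×-homo-+)
open import Data.Bool using (true; false; if_then_else_)
open import Data.Bool.Properties using (not-involutive)
import Data.Bool.Properties as Bool
open import Data.Fin using (Fin; zero; suc)
import Data.Fin.Properties as Fin
open import Data.Fin.Subset using (Subset; Side; inside; outside; _∈_; _∉_; ⁅_⁆; ⊥; ∁; ∣_∣)
open import Data.Fin.Subset.Properties using (_∈?_; x∈⁅x⁆; x∈⁅y⁆⇒x≡y; ⊆-antisym; ∣∁p∣≡n∸∣p∣; ∣p∣≤n)
open import Data.Integer using (+_; -[1+_])
import Data.Integer as ℤ
import Data.Integer.Properties as ℤ
open import Data.List using (List; []; _∷_; map; filter; _++_; foldr; length; allFin; concatMap; lookup)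
open import Data.List.Extrema.Nat using (xs≤max)
import Data.List.Membership.DecPropositional as DecMembership
open import Data.List.Membership.Propositional using () renaming (_∈_ to _∈ˡ_; _∉_ to _∉ˡ_)
open import Data.List.Membership.Propositional.Properties using (∈-allFin; ∈-filter⁺; ∈-filter⁻; ∈-concatMap⁺; ∈-map⁺)
open import Data.List.Properties using (length-++)
open import Data.List.Relation.Unary.All as All using (All; []; _∷_)
open import Data.List.Relation.Unary.AllPairs using (AllPairs; []; _∷_)
open import Data.List.Relation.Unary.Any as Any using (Any; here; there)
open import Data.List.Relation.Unary.Any.Properties using (lookup-index)
open import Data.Nat using (ℕ; zero; suc; _≤_; _<_; _+_; _*_; _^_; _∸_; z≤n; s≤s)
import Data.Nat as ℕ
import Data.Nat.Properties as ℕ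
open import Data.Nat.Solver using () renaming (module +-*-Solver to ℕ-Solver)
open import Data.Rational using (ℚ; mkℚ; 0ℚ; 1ℚ; ½)
import Data.Rational as ℚ
import Data.Rational.Properties as ℚ
open import Data.Rational.Solver using (module +-*-Solver)
import Data.Rational.Unnormalised as ℚᵘ
import Data.Rational.Unnormalised.Properties as ℚᵘ
open import Data.Product using (Σ; _×_; _,_; ∃-syntax; proj₁; proj₂)
open import Data.Sum using (_⊎_; inj₁; inj₂; [_,_]′)
open import Data.Vec using (_[_]≔_)
import Data.Vec as Vec
import Data.Vec.Properties as Vec
open import Function using (_∘_; case_of_)
open import Relation.Binary.Construct.Closure.ReflexiveTransitive using (Star; ε; _◅_)
open import Relation.Binary.PropositionalEquality using (_≡_; _≢_; refl; sym; trans; cong; cong₂; subst; subst₂;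
  module ≡-Reasoning)
open import Relation.Nullary using (¬_; yes; no; does; contradiction)
open import Relation.Nullary.Decidable using (_×-dec_; _→-dec_; ¬?)
import Relation.Unary as U

private
  variable
    n : ℕ
    P Q R : Subset n → Set

-- Counting sets

-- The recursion splits on the first coordinate exactly as that of `𝔼` does, so counting lemmas go
-- by induction on `n` and `count-𝔼` can compare the two half by half.
count : {P : Subset n → Set} → U.Decidable P → ℕ
count {zero}  P? = if does (P? Vec.[]) then 1 else 0
count {suc n} P? = count (λ C → P? (outside Vec.∷ C)) + count (λ C → P? (inside Vec.∷ C))

private
  interchange : ∀ a b c d → (a + c) + (b + d) ≡ (a + b) + (c + d)
  interchange = solve 4 (λ a b c d → (a :+ c) :+ (b :+ d) := (a :+ b) :+ (c :+ d)) refl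
    where open ℕ-Solver

count-∪ : (P? : U.Decidable P) (Q? : U.Decidable Q) (R? : U.Decidable R) →
          (∀ C → P C → Q C ⊎ R C) → count {n} P? ≤ count Q? + count R?
count-∪ {n = zero} P? Q? R? f with P? Vec.[] | Q? Vec.[] | R? Vec.[]
... | no  _ | _     | _     = z≤n
... | yes _ | yes _ | _     = s≤s z≤n
... | yes _ | no  _ | yes _ = s≤s z≤n
... | yes p | no ¬q | no ¬r = contradiction (f Vec.[] p) [ ¬q , ¬r ]′
count-∪ {n = suc n} P? Q? R? f = ℕ.≤-trans
  (ℕ.+-mono-≤ (count-∪ {n = n} _ _ _ (f ∘ (outside Vec.∷_))) (count-∪ {n = n} _ _ _ (f ∘ (inside Vec.∷_))))
  (ℕ.≤-reflexive (interchange (count (λ C → Q? (outside Vec.∷ C))) (count (λ C → Q? (inside Vec.∷ C))) _ _))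

count-disjoint : (P? : U.Decidable P) (Q? : U.Decidable Q) (R? : U.Decidable R) →
                 (∀ C → P C → R C) → (∀ C → Q C → R C) → (∀ C → P C → ¬ Q C) →
                 count {n} P? + count Q? ≤ count R?
count-disjoint {n = zero} P? Q? R? f g h with P? Vec.[] | Q? Vec.[] | R? Vec.[]
... | yes p | yes q | _     = contradiction q (h Vec.[] p)
... | yes p | no _  | yes _ = s≤s z≤n
... | yes p | no _  | no ¬r = contradiction (f Vec.[] p) ¬r
... | no _  | yes q | yes _ = s≤s z≤n
... | no _  | yes q | no ¬r = contradiction (g Vec.[] q) ¬r
... | no _  | no _  | _     = z≤n
count-disjoint {n = suc n} P? Q? R? f g h = ℕ.≤-trans
  (ℕ.≤-reflexive (interchange (count (λ C → P? (outside Vec.∷ C))) (count (λ C → Q? (outside Vec.∷ C))) _ _))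
  (ℕ.+-mono-≤
    (count-disjoint {n = n} _ _ _ (f ∘ (outside Vec.∷_)) (g ∘ (outside Vec.∷_)) (h ∘ (outside Vec.∷_)))
    (count-disjoint {n = n} _ _ _ (f ∘ (inside Vec.∷_)) (g ∘ (inside Vec.∷_)) (h ∘ (inside Vec.∷_))))

count≤2^n : (P? : U.Decidable P) → count {n} P? ≤ 2 ^ n
count≤2^n {n = zero} P? with does (P? Vec.[])
... | true  = s≤s z≤n
... | false = z≤n
count≤2^n {n = suc n} P? = ℕ.+-mono-≤ (count≤2^n {n = n} _)
  (ℕ.≤-trans (count≤2^n {n = n} _) (ℕ.m≤m+n (2 ^ n) 0))

count-∅ : (P? : U.Decidable P) → (∀ C → ¬ P C) → count {n} P? ≡ 0
count-∅ {n = zero} P? ¬P with P? Vec.[]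
... | yes p = contradiction p (¬P Vec.[])
... | no _  = refl
count-∅ {n = suc n} P? ¬P = cong₂ _+_
  (count-∅ {n = n} _ (¬P ∘ (outside Vec.∷_)))
  (count-∅ {n = n} _ (¬P ∘ (inside Vec.∷_)))

count-≡ : (P? : U.Decidable P) (D : Subset n) → (∀ C → P C → C ≡ D) → count P? ≤ 1
count-≡ {n = zero} P? D f with does (P? Vec.[])
... | true  = s≤s z≤n
... | false = z≤n
count-≡ {n = suc n} P? (inside Vec.∷ D) f
  rewrite count-∅ {n = n} (λ C → P? (outside Vec.∷ C)) (λ C p → case f _ p of λ ()) =
  count-≡ _ D (λ C p → Vec.∷-injectiveʳ (f _ p))
count-≡ {n = suc n} P? (outside Vec.∷ D) f
  rewrite count-∅ {n = n} (λ C → P? (inside Vec.∷ C)) (λ C p → case f _ p of λ ())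
        | ℕ.+-identityʳ (count (λ C → P? (outside Vec.∷ C))) =
  count-≡ _ D (λ C p → Vec.∷-injectiveʳ (f _ p))

count-mono : (P? : U.Decidable P) (Q? : U.Decidable Q) → (∀ C → P C → Q C) → count {n} P? ≤ count Q?
count-mono {n = zero} P? Q? f with P? Vec.[] | Q? Vec.[]
... | no _  | _     = z≤n
... | yes _ | yes _ = s≤s z≤n
... | yes p | no ¬q = contradiction (f Vec.[] p) ¬q
count-mono {n = suc n} P? Q? f = ℕ.+-mono-≤
  (count-mono {n = n} _ _ (f ∘ (outside Vec.∷_))) (count-mono {n = n} _ _ (f ∘ (inside Vec.∷_)))

-- Overwriting one entry is at most two-to-one.
count-assign : (P? : U.Decidable P) (Q? : U.Decidable Q) (x : Fin n) (b : Side) →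
               (∀ C → P C → Q (C [ x ]≔ b)) → count P? ≤ 2 * count Q?
count-assign {n = suc n} P? Q? zero b f = ℕ.+-mono-≤
  (half outside) (ℕ.≤-trans (half inside) (ℕ.m≤m+n _ 0))
  where
  half : ∀ c → count (λ C → P? (c Vec.∷ C)) ≤ count Q?
  half c = ℕ.≤-trans (count-mono _ (λ C → Q? (b Vec.∷ C)) (λ C → f (c Vec.∷ C))) (side b)
    where
    side : ∀ b → count (λ C → Q? (b Vec.∷ C)) ≤ count Q?
    side outside = ℕ.m≤m+n _ _
    side inside  = ℕ.m≤n+m _ _
count-assign {n = suc n} P? Q? (suc x) b f = ℕ.≤-trans
  (ℕ.+-mono-≤ (count-assign _ _ x b (f ∘ (outside Vec.∷_))) (count-assign _ _ x b (f ∘ (inside Vec.∷_))))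
  (ℕ.≤-reflexive (sym (ℕ.*-distribˡ-+ 2 (count (λ C → Q? (outside Vec.∷ C))) _)))

-- Isolated vertices

clear : List (Fin n) → Subset n → Subset n
clear xs C = foldr (λ x D → D [ x ]≔ outside) C xs

-- Each entry of `xs` is one overwrite by `outside`, and each overwrite is at most two-to-one.
count-clear : (P? : U.Decidable P) (Q? : U.Decidable Q) (xs : List (Fin n)) →
              (∀ C → P C → Q (clear xs C)) → count P? ≤ 2 ^ length xs * count Q?
count-clear P? Q? []       f = ℕ.≤-trans (count-mono P? Q? f) (ℕ.m≤m+n _ 0)
count-clear P? Q? (x ∷ xs) f = begin
  count P?
    ≤⟨ count-clear P? (λ C → Q? (C [ x ]≔ outside)) xs f ⟩
  2 ^ length xs * count (λ C → Q? (C [ x ]≔ outside))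
    ≤⟨ ℕ.*-monoʳ-≤ (2 ^ length xs) (count-assign (λ C → Q? (C [ x ]≔ outside)) Q? x outside (λ _ q → q)) ⟩
  2 ^ length xs * (2 * count Q?)
    ≡⟨ solve 2 (λ a c → a :* (con 2 :* c) := con 2 :* a :* c) refl (2 ^ length xs) (count Q?) ⟩
  2 ^ length (x ∷ xs) * count Q? ∎
  where
  open ℕ.≤-Reasoning
  open ℕ-Solver

∉-clear : ∀ x (C : Subset n) → x ∉ C [ x ]≔ outside
∉-clear x C x∈ with trans (sym (Vec.[]=⇒lookup x∈)) (Vec.lookup∘update x C outside)
... | ()

∈-assign : ∀ x (C : Subset n) → x ∈ C [ x ]≔ inside
∈-assign x C = Vec.[]≔-updates C x

∈-assign⁺ : ∀ {x y b} {C : Subset n} → y ≢ x → y ∈ C → y ∈ C [ x ]≔ b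
∈-assign⁺ {x = x} {y} {C = C} y≢x = Vec.[]≔-minimal C y x y≢x

∈-assign⁻ : ∀ {x y b} {C : Subset n} → y ≢ x → y ∈ C [ x ]≔ b → y ∈ C
∈-assign⁻ {y = y} {b} {C} y≢x y∈ = Vec.lookup⇒[]= y C
  (trans (sym (Vec.lookup∘update′ y≢x C b)) (Vec.[]=⇒lookup y∈))

∉-clear-list : ∀ {xs y} (C : Subset n) → y ∈ˡ xs → y ∉ clear xs C
∉-clear-list {xs = x ∷ xs} C (here refl) = ∉-clear x (clear xs C)
∉-clear-list {xs = x ∷ xs} {y} C (there y∈) y∈C with y Fin.≟ x
... | yes refl = ∉-clear x (clear xs C) y∈C
... | no y≢x   = ∉-clear-list C y∈ (∈-assign⁻ y≢x y∈C)

-- Pigeonhole: if every vertex occurred in `xs`, `Any.index` would be an injection from `Fin n` into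
-- the positions of a shorter list.
outside-list : ∀ (xs : List (Fin n)) → length xs < n → ∃[ u ] u ∉ˡ xs
outside-list {n} xs len<n = Fin.¬∀⟶∃¬ n (_∈ˡ xs) (_∈?ˡ xs) λ all∈ →
  ℕ.<⇒≱ len<n (Fin.injective⇒≤ {f = λ u → Any.index (all∈ u)} λ {u} {v} eq →
    trans (lookup-index (all∈ u)) (trans (cong (lookup xs) eq) (sym (lookup-index (all∈ v)))))
  where open DecMembership Fin._≟_ using () renaming (_∈?_ to _∈?ˡ_)

length-concatMap : ∀ {A B : Set} (f : A → List B) s → (∀ x → length (f x) ≤ s) →
                   ∀ xs → length (concatMap f xs) ≤ length xs * s
length-concatMap f s h []       = z≤n
length-concatMap f s h (x ∷ xs) = ℕ.≤-trans (ℕ.≤-reflexive (length-++ (f x)))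
  (ℕ.+-mono-≤ (h x) (length-concatMap f s h xs))

n<2^n : ∀ n → n < 2 ^ n
n<2^n zero    = s≤s z≤n
n<2^n (suc n) = ℕ.+-mono-≤ (ℕ.m^n>0 2 n) (ℕ.≤-trans (n<2^n n) (ℕ.m≤m+n (2 ^ n) 0))

module _ (G : Graph n) where

  neighbours : Fin n → List (Fin n)
  neighbours v = filter (Adj? G v) (allFin n)

  neighbourhood : Fin n → List (Fin n)
  neighbourhood v = v ∷ neighbours v

  neighbour⁺ : ∀ {v w} → Adj G v w → w ∈ˡ neighbours v
  neighbour⁺ {v} {w} = ∈-filter⁺ (Adj? G v) (∈-allFin w)

  neighbour⁻ : ∀ {v w} → w ∈ˡ neighbours v → Adj G v w
  neighbour⁻ {v} w∈ = proj₂ (∈-filter⁻ (Adj? G v) {xs = allFin n} w∈)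

  neighbourhood-sym : ∀ {v w} → w ∈ˡ neighbourhood v → v ∈ˡ neighbourhood w
  neighbourhood-sym (here refl) = here refl
  neighbourhood-sym (there w∈)  = there (neighbour⁺ (symm G (neighbour⁻ w∈)))

  length-neighbourhood : ∀ v → length (neighbourhood v) ≤ suc (maxDegree G)
  length-neighbourhood v = s≤s (All.lookup (xs≤max 0 (map (degree G) (allFin n)))
    (∈-map⁺ (degree G) (∈-allFin v)))

  Isolated : Fin n → Subset n → Set
  Isolated v C = v ∈ C × (∀ w → Adj G v w → w ∉ C)

  isolated? : ∀ v → U.Decidable (Isolated v)
  isolated? v C = (v ∈? C) ×-dec Fin.all? λ w → Adj? G v w →-dec ¬? (w ∈? C)

  isolate : Fin n → Subset n → Subset n
  isolate v C = clear (neighbours v) C [ v ]≔ inside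

  isolated-isolate : ∀ v C → Isolated v (isolate v C)
  isolated-isolate v C = ∈-assign v (clear (neighbours v) C) , λ w vw w∈ →
    ∉-clear-list C (neighbour⁺ vw) (∈-assign⁻ (λ { refl → irrefl G vw }) w∈)

  -- Whether `v` is isolated depends only on the entries in its closed neighbourhood, and `x` lies
  -- outside it.
  isolated-assign⁻ : ∀ {v x b C} → x ∉ˡ neighbourhood v → Isolated v (C [ x ]≔ b) → Isolated v C
  isolated-assign⁻ x∉ (v∈ , alone) =
    ∈-assign⁻ (x∉ ∘ here ∘ sym) v∈ , λ w vw w∈ →
      alone w vw (∈-assign⁺ (λ { refl → x∉ (there (neighbour⁺ vw)) }) w∈)

  -- Equivalent to distance at least three. It ensures that `isolate u` leaves alone all entries
  -- that decide whether `v` is isolated.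
  Far : Fin n → Fin n → Set
  Far u v = ∀ {x} → x ∈ˡ neighbourhood u → x ∉ˡ neighbourhood v

  isolated-clear⁻ : ∀ {v C} xs → (∀ {x} → x ∈ˡ xs → x ∉ˡ neighbourhood v) →
                    Isolated v (clear xs C) → Isolated v C
  isolated-clear⁻ []       far i = i
  isolated-clear⁻ (x ∷ xs) far i =
    isolated-clear⁻ xs (far ∘ there) (isolated-assign⁻ (far (here refl)) i)

  isolated-isolate⁻ : ∀ {u v C} → Far u v → Isolated v (isolate u C) → Isolated v C
  isolated-isolate⁻ far i =
    isolated-clear⁻ _ (far ∘ there) (isolated-assign⁻ (far (here refl)) i)

  NoneIsolated : List (Fin n) → Subset n → Set
  NoneIsolated vs C = All (λ v → ¬ Isolated v C) vs

  noneIsolated? : ∀ vs → U.Decidable (NoneIsolated vs)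
  noneIsolated? vs C = All.all? (λ v → ¬? (isolated? v C)) vs

  noneIsolated-isolate : ∀ {u vs C} → All (Far u) vs →
                         NoneIsolated vs C → NoneIsolated vs (isolate u C)
  noneIsolated-isolate []           []       = []
  noneIsolated-isolate (far ∷ fars) (p ∷ ps) =
    (p ∘ isolated-isolate⁻ far) ∷ noneIsolated-isolate fars ps

  -- Greedy choice: a chosen vertex rules out only the vertices within distance two of it, at most
  -- `s * s` many, so there is room for another vertex while `length vs * (s * s) < n`.
  far-vertices : ∀ m → m * (suc (maxDegree G) * suc (maxDegree G)) ≤ n →
                 ∃[ vs ] (length vs ≡ m × AllPairs Far vs)
  far-vertices zero    _    = [] , refl , []
  far-vertices (suc m) room with far-vertices m (ℕ.≤-trans (ℕ.m≤n+m _ _) room)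
  ... | vs , refl , far =
    let u , u∉ = outside-list (concatMap neighbourhood (concatMap neighbourhood vs)) (begin-strict
          length (concatMap neighbourhood (concatMap neighbourhood vs))
            ≤⟨ length-concatMap neighbourhood s length-neighbourhood (concatMap neighbourhood vs) ⟩
          length (concatMap neighbourhood vs) * s
            ≤⟨ ℕ.*-monoˡ-≤ s (length-concatMap neighbourhood s length-neighbourhood vs) ⟩
          length vs * s * s
            ≡⟨ ℕ.*-assoc (length vs) s s ⟩
          length vs * (s * s)
            <⟨ ℕ.m<n+m (length vs * (s * s)) {s * s} (s≤s z≤n) ⟩
          s * s + length vs * (s * s)
            ≤⟨ room ⟩
          n ∎)
    in u ∷ vs , refl ,
       -- A common point `x` of the closed neighbourhoods of `u` and `v` would put `u` within
       -- distance two of `v` by way of `x`, hence into the list that `u` avoids.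
       All.tabulate (λ v∈vs {x} x∈u x∈v → u∉ (∈-concatMap⁺ neighbourhood
         (Any.map (λ { refl → neighbourhood-sym x∈u })
           (∈-concatMap⁺ neighbourhood (Any.map (λ { refl → x∈v }) v∈vs))))) ∷ far
    where
    open ℕ.≤-Reasoning
    s = suc (maxDegree G)

  -- Counting the sets that isolate none of the chosen vertices

  private
    K : ℕ
    K = 2 ^ suc (maxDegree G)

  -- The map `isolate u` keeps all of `vs` non-isolated, because they are far from `u`, and makes
  -- `u` isolated. It overwrites one entry per vertex of the closed neighbourhood of `u`, so it is
  -- at most `K`-to-one.
  count-isolated : ∀ u vs → All (Far u) vs → count (noneIsolated? vs) ≤
                   K * count (λ C → noneIsolated? vs C ×-dec isolated? u C)
  count-isolated u vs far = begin
    count (noneIsolated? vs)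
      ≤⟨ count-clear (noneIsolated? vs) (λ C → both? (C [ u ]≔ inside)) (neighbours u)
           (λ C p → noneIsolated-isolate far p , isolated-isolate u C) ⟩
    2 ^ d * count (λ C → both? (C [ u ]≔ inside))
      ≤⟨ ℕ.*-monoʳ-≤ (2 ^ d) (count-assign (λ C → both? (C [ u ]≔ inside)) both? u inside (λ _ q → q)) ⟩
    2 ^ d * (2 * count both?)
      ≡⟨ solve 2 (λ a c → a :* (con 2 :* c) := con 2 :* a :* c) refl (2 ^ d) (count both?) ⟩
    2 ^ suc d * count both?
      ≤⟨ ℕ.*-monoˡ-≤ (count both?) (ℕ.^-monoʳ-≤ 2 (length-neighbourhood u)) ⟩
    K * count both? ∎
    where
    open ℕ.≤-Reasoning
    open ℕ-Solver
    d = length (neighbours u)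
    both? : U.Decidable (λ C → NoneIsolated vs C × Isolated u C)
    both? C = noneIsolated? vs C ×-dec isolated? u C

  -- A division-free form of the bound `K / (K + l)` on the proportion of such sets, where
  -- `l = length vs`. It is weaker than `(1 - 1/K)^l`, but needs no estimate of powers and gives 1/5
  -- at `l = 4K`.
  count-noneIsolated : ∀ vs → AllPairs Far vs →
                       (K + length vs) * count (noneIsolated? vs) ≤ K * 2 ^ n
  count-noneIsolated [] [] = ℕ.*-mono-≤ (ℕ.≤-reflexive (ℕ.+-identityʳ K)) (count≤2^n (noneIsolated? []))
  count-noneIsolated (u ∷ vs) (far ∷ fars) = begin
    (K + suc l) * a          ≡⟨ solve 3 (λ K l a → (K :+ (con 1 :+ l)) :* a := K :* a :+ a :+ l :* a) refl K l a ⟩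
    K * a + a + l * a
      -- The single `a` is bounded by `a ≤ c ≤ K * b`. The resulting `K * b` then joins `K * a`, and
      -- `a + b ≤ c` because `u` is either isolated or not.
      ≤⟨ ℕ.+-mono-≤ (ℕ.+-monoʳ-≤ (K * a) (ℕ.≤-trans a≤c (count-isolated u vs far)))
                    (ℕ.*-monoʳ-≤ l a≤c) ⟩
    K * a + K * b + l * c    ≡⟨ cong (_+ l * c) (sym (ℕ.*-distribˡ-+ K a b)) ⟩
    K * (a + b) + l * c      ≤⟨ ℕ.+-monoˡ-≤ (l * c) (ℕ.*-monoʳ-≤ K a+b≤c) ⟩
    K * c + l * c            ≡⟨ sym (ℕ.*-distribʳ-+ c K l) ⟩
    (K + l) * c              ≤⟨ count-noneIsolated vs fars ⟩
    K * 2 ^ n                ∎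
    where
    open ℕ.≤-Reasoning
    open ℕ-Solver
    l = length vs
    a = count (noneIsolated? (u ∷ vs))
    c = count (noneIsolated? vs)
    b = count (λ C → noneIsolated? vs C ×-dec isolated? u C)
    a+b≤c : a + b ≤ c
    a+b≤c = count-disjoint (noneIsolated? (u ∷ vs)) _ (noneIsolated? vs)
      (λ C → All.tail) (λ C → proj₁) (λ { C (¬i ∷ _) (_ , i) → ¬i i })
    a≤c : a ≤ c
    a≤c = ℕ.≤-trans (ℕ.m≤m+n a b) a+b≤c

  -- A nontrivial walk inside `C` starting at `v` would have to step first to a neighbour of `v` in
  -- `C`.
  connected-isolated : ∀ {v C} → ConnectedSet G C → Isolated v C → C ≡ ⁅ v ⁆
  connected-isolated {v} {C} (_ , conn) (v∈ , alone) = ⊆-antisym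
    (λ {u} u∈ → subst (_∈ ⁅ v ⁆) (reach (conn v u v∈ u∈)) (x∈⁅x⁆ v))
    (λ u∈ → subst (_∈ C) (sym (x∈⁅y⁆⇒x≡y v u∈)) v∈)
    where
    reach : ∀ {u} → Star (InducedAdj G C) v u → v ≡ u
    reach ε                       = refl
    reach ((_ , w∈ , vw) ◅ _) = contradiction w∈ (alone _ vw)

  private
    is? : ∀ v → U.Decidable (λ (C : Subset n) → C ≡ ⁅ v ⁆)
    is? v C = Vec.≡-dec Bool._≟_ C ⁅ v ⁆

    singleton? : ∀ vs → U.Decidable (λ (C : Subset n) → Any (λ v → C ≡ ⁅ v ⁆) vs)
    singleton? vs C = Any.any? (λ v → is? v C) vs

  count-singleton : ∀ vs → count (singleton? vs) ≤ length vs
  count-singleton []       = ℕ.≤-reflexive (count-∅ (singleton? []) λ _ ())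
  count-singleton (v ∷ vs) = ℕ.≤-trans
    (count-∪ (singleton? (v ∷ vs)) (is? v) (singleton? vs)
      (λ { C (here eq) → inj₁ eq ; C (there p) → inj₂ p }))
    (ℕ.+-mono-≤ (count-≡ (is? v) ⁅ v ⁆ (λ _ eq → eq)) (count-singleton vs))

  count-connected : ∀ vs → count (connectedSet? G) ≤ count (noneIsolated? vs) + length vs
  count-connected vs = ℕ.≤-trans
    (count-∪ (connectedSet? G) (noneIsolated? vs) (singleton? vs) (λ C conn → split C conn vs))
    (ℕ.+-monoʳ-≤ (count (noneIsolated? vs)) (count-singleton vs))
    where
    split : ∀ C → ConnectedSet G C → ∀ vs → NoneIsolated vs C ⊎ Any (λ v → C ≡ ⁅ v ⁆) vs
    split C conn []       = inj₁ []
    split C conn (v ∷ vs) with isolated? v C | split C conn vs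
    ... | yes i | _       = inj₂ (here (connected-isolated conn i))
    ... | no _  | inj₂ p  = inj₂ (there p)
    ... | no ¬i | inj₁ ps = inj₁ (¬i ∷ ps)

-- With `K = 2 ^ suc Δ`, finding `4 * K` far vertices takes `4 * K * (suc Δ * suc Δ)` vertices. The
-- larger factor 40 also gives `40 * K ≤ n < 2 ^ n`, which absorbs the singletons in
-- `few-connected`.
threshold : ℕ → ℕ
threshold Δ = 40 * 2 ^ suc Δ * (suc Δ * suc Δ)

few-connected : ∀ (G : Graph n) → threshold (maxDegree G) ≤ n → 2 * count (connectedSet? G) < 2 ^ n
few-connected {n} G large with far-vertices G (4 * 2 ^ suc (maxDegree G))
    (ℕ.≤-trans (ℕ.*-monoˡ-≤ (suc (maxDegree G) * suc (maxDegree G))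
      (ℕ.*-monoˡ-≤ (2 ^ suc (maxDegree G)) {4} {40} (ℕ.m≤m+n 4 36))) large)
-- The factor 5 clears the denominator of the bound 1/5 on the proportion of sets isolating none of
-- `vs`.
... | vs , len , far = ℕ.*-cancelˡ-< 5 _ _ (begin-strict
    5 * (2 * count (connectedSet? G))
      ≤⟨ ℕ.*-monoʳ-≤ 5 (ℕ.*-monoʳ-≤ 2 (count-connected G vs)) ⟩
    5 * (2 * (a + length vs))
      ≡⟨ cong (λ l → 5 * (2 * (a + l))) len ⟩
    5 * (2 * (a + 4 * K))
      ≡⟨ solve 2 (λ a K → con 5 :* (con 2 :* (a :+ con 4 :* K)) := con 2 :* (con 5 :* a) :+ con 40 :* K) refl a K ⟩
    2 * (5 * a) + 40 * K
      -- The first summand uses `5 * a ≤ T`, which is `count-noneIsolated` at length `4 * K` with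
      -- `K` cancelled. The strict inequality comes from `n < 2 ^ n`.
      <⟨ ℕ.+-mono-≤-< (ℕ.*-monoʳ-≤ 2 5a≤T) (ℕ.≤-<-trans (ℕ.≤-trans (ℕ.m≤m*n (40 * K) (s * s)) large) (n<2^n n)) ⟩
    2 * T + T
      ≤⟨ ℕ.≤-trans (ℕ.m≤m+n (2 * T + T) (2 * T))
           (ℕ.≤-reflexive (solve 1 (λ T → con 2 :* T :+ T :+ con 2 :* T := con 5 :* T) refl T)) ⟩
    5 * T ∎)
  where
  open ℕ.≤-Reasoning
  open ℕ-Solver
  s = suc (maxDegree G)
  K = 2 ^ s
  T = 2 ^ n
  a = count (noneIsolated? G vs)
  5a≤T : 5 * a ≤ T
  5a≤T = ℕ.*-cancelˡ-≤ K {{ℕ.m^n≢0 2 s}} (begin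
    K * (5 * a)            ≡⟨ solve 2 (λ K a → K :* (con 5 :* a) := (K :+ con 4 :* K) :* a) refl K a ⟩
    (K + 4 * K) * a        ≡⟨ cong (λ l → (K + l) * a) (sym len) ⟩
    (K + length vs) * a    ≤⟨ count-noneIsolated G vs far ⟩
    K * T                  ∎)

-- Sets connected in every 2-connected graph

∁-involutive : ∀ (C : Subset n) → ∁ (∁ C) ≡ C
∁-involutive Vec.[]      = refl
∁-involutive (b Vec.∷ C) = cong₂ Vec._∷_ (not-involutive b) (∁-involutive C)

-- The complement of `C` has at most one vertex, so 2-connectivity applies to its removal; what
-- remains is `∁ (∁ C)`.
co-singleton-connected : ∀ (G : Graph n) → KConnected 2 G →
                         ∀ C → n ≤ suc ∣ C ∣ → ConnectedSet G C
co-singleton-connected {n} G (_ , conn) C n≤ = subst (ConnectedSet G) (∁-involutive C)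
  (conn (∁ C) (s≤s (ℕ.≤-trans (ℕ.≤-reflexive (∣∁p∣≡n∸∣p∣ C))
    (ℕ.≤-trans (ℕ.∸-monoˡ-≤ ∣ C ∣ n≤) (ℕ.≤-reflexive (ℕ.m+n∸n≡m 1 ∣ C ∣))))))

∣p∣≡0⇒p≡⊥ : ∀ (C : Subset n) → ∣ C ∣ ≡ 0 → C ≡ ⊥
∣p∣≡0⇒p≡⊥ Vec.[]            _  = refl
∣p∣≡0⇒p≡⊥ (outside Vec.∷ C) eq = cong (outside Vec.∷_) (∣p∣≡0⇒p≡⊥ C eq)

∣p∣≡1⇒p≡⁅x⁆ : ∀ (C : Subset n) → ∣ C ∣ ≡ 1 → ∃[ v ] C ≡ ⁅ v ⁆
∣p∣≡1⇒p≡⁅x⁆ (inside Vec.∷ C)  eq = zero , cong (inside Vec.∷_) (∣p∣≡0⇒p≡⊥ C (ℕ.suc-injective eq))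
∣p∣≡1⇒p≡⁅x⁆ (outside Vec.∷ C) eq =
  let v , C≡ = ∣p∣≡1⇒p≡⁅x⁆ C eq in suc v , cong (outside Vec.∷_) C≡

singleton-connected : ∀ (G : Graph n) C → ∣ C ∣ ≡ 1 → ConnectedSet G C
singleton-connected G C eq with ∣p∣≡1⇒p≡⁅x⁆ C eq
... | v , refl = (v , x∈⁅x⁆ v) , λ u w u∈ w∈ →
  subst (Star _ u) (trans (x∈⁅y⁆⇒x≡y v u∈) (sym (x∈⁅y⁆⇒x≡y v w∈))) ε

-- Rational arithmetic

open +-*-Solver using (solve; _:+_; _:*_; :-_; _:-_; con; _:=_)
open RawSemiring ℚ.+-*-rawSemiring using () renaming (_×_ to _×ℚ_; _^_ to _^ℚ_)

-- Rational inequalities are certified by writing the difference of the two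
-- sides as a sum of products of nonnegative terms.

≤-by : ∀ {a b} d → 0ℚ ℚ.≤ d → a ℚ.+ d ≡ b → a ℚ.≤ b
≤-by {a} d 0≤d eq =
  subst₂ ℚ._≤_ (ℚ.+-identityʳ a) eq (ℚ.+-monoʳ-≤ a 0≤d)

<-by : ∀ {a b} d → 0ℚ ℚ.< d → a ℚ.+ d ≡ b → a ℚ.< b
<-by {a} d 0<d eq =
  subst₂ ℚ._<_ (ℚ.+-identityʳ a) eq (ℚ.+-monoʳ-< a 0<d)

add-difference : ∀ a b → a ℚ.+ (b ℚ.- a) ≡ b
add-difference = solve 2 (λ a b → a :+ (b :- a) := b) refl

0≤difference : ∀ {a b} → a ℚ.≤ b → 0ℚ ℚ.≤ b ℚ.- a
0≤difference {a} {b} a≤b =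
  subst (ℚ._≤ b ℚ.- a) (ℚ.+-inverseʳ a) (ℚ.+-monoˡ-≤ (ℚ.- a) a≤b)

0<difference : ∀ {a b} → a ℚ.< b → 0ℚ ℚ.< b ℚ.- a
0<difference {a} {b} a<b =
  subst (ℚ._< b ℚ.- a) (ℚ.+-inverseʳ a) (ℚ.+-monoˡ-< (ℚ.- a) a<b)

0≤+ : ∀ {a b} → 0ℚ ℚ.≤ a → 0ℚ ℚ.≤ b → 0ℚ ℚ.≤ a ℚ.+ b
0≤+ = ℚ.+-mono-≤

0≤* : ∀ {a b} → 0ℚ ℚ.≤ a → 0ℚ ℚ.≤ b → 0ℚ ℚ.≤ a ℚ.* b
0≤* {a} {b} 0≤a 0≤b = ℚ.nonNegative⁻¹ (a ℚ.* b)
  {{ℚ.nonNeg*nonNeg⇒nonNeg a {{ℚ.nonNegative 0≤a}} b {{ℚ.nonNegative 0≤b}}}}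

0<* : ∀ {a b} → 0ℚ ℚ.< a → 0ℚ ℚ.< b → 0ℚ ℚ.< a ℚ.* b
0<* {a} {b} 0<a 0<b = ℚ.positive⁻¹ (a ℚ.* b)
  {{ℚ.pos*pos⇒pos a {{ℚ.positive 0<a}} b {{ℚ.positive 0<b}}}}

0<½ : 0ℚ ℚ.< ½
0<½ = ℚ.positive⁻¹ ½

0<1 : 0ℚ ℚ.< 1ℚ
0<1 = ℚ.positive⁻¹ 1ℚ

divisible : ∀ {a} b → 0ℚ ℚ.< a → 0ℚ ℚ.< b → ∃[ c ] (0ℚ ℚ.< c × a ℚ.* c ≡ b)
divisible {a} b 0<a 0<b = ℚ.1/ a ℚ.* b , 0<* (ℚ.positive⁻¹ (ℚ.1/ a)) 0<b ,
  trans (sym (ℚ.*-assoc a (ℚ.1/ a) b))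
    (trans (cong (ℚ._* b) (ℚ.*-inverseʳ a)) (ℚ.*-identityˡ b))
  where
  instance
    a-pos : ℚ.Positive a
    a-pos = ℚ.positive 0<a
    a≢0 : ℚ.NonZero a
    a≢0 = ℚ.pos⇒nonZero a
    1/a-pos : ℚ.Positive (ℚ.1/ a)
    1/a-pos = ℚ.1/pos⇒pos a

-- As a repeated sum of ones, `ι (suc n)` unfolds to `1ℚ ℚ.+ ι n`, the form in which the inductions
-- below pass it to the solver.
ι : ℕ → ℚ
ι n = n ×ℚ 1ℚ

ι-homo-+ : ∀ m n → ι (m ℕ.+ n) ≡ ι m ℚ.+ ι n
ι-homo-+ = ×-homo-+ semiring 1ℚ
  where
  open CommutativeRing ℚ.+-*-commutativeRing using (semiring)

0≤ι : ∀ n → 0ℚ ℚ.≤ ι n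
0≤ι zero    = ℚ.≤-refl
0≤ι (suc n) = 0≤+ (ℚ.<⇒≤ 0<1) (0≤ι n)

0<ι : ∀ n → 0ℚ ℚ.< ι (suc n)
0<ι n = ℚ.+-mono-<-≤ 0<1 (0≤ι n)

ι-mono-≤ : ∀ {m n} → m ≤ n → ι m ℚ.≤ ι n
ι-mono-≤ {n = n} ℕ.z≤n = 0≤ι n
ι-mono-≤ (ℕ.s≤s m≤n)   = ℚ.+-monoʳ-≤ 1ℚ (ι-mono-≤ m≤n)

ι-mono-< : ∀ {m n} → m ℕ.< n → ι m ℚ.< ι n
ι-mono-< {m} m<n = ℚ.<-≤-trans
  (<-by 1ℚ 0<1 (ℚ.+-comm (ι m) 1ℚ)) (ι-mono-≤ m<n)

toℚᵘ-ι : ∀ n → ℚ.toℚᵘ (ι n) ℚᵘ.≃ ℚᵘ.mkℚᵘ (+ n) 0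
toℚᵘ-ι zero    = ℚᵘ.≃-refl
toℚᵘ-ι (suc n) = ℚᵘ.≃-trans (ℚ.toℚᵘ-homo-+ 1ℚ (ι n))
  (ℚᵘ.≃-trans (ℚᵘ.+-congʳ ℚᵘ.1ℚᵘ (toℚᵘ-ι n))
    (ℚᵘ.*≡* (cong (ℤ._* + 1) (cong (λ z → + 1 ℤ.+ z) (ℤ.*-identityʳ (+ n))))))

-- The denominator is at least one, so the absolute value of the numerator is a bound.
archimedean : ∀ q → ∃[ n ] q ℚ.≤ ι n
archimedean q = ℤ.∣ ℚ.↥ q ∣ , ℚ.toℚᵘ-cancel-≤ (ℚᵘ.≤-respʳ-≃
  (ℚᵘ.≃-sym (toℚᵘ-ι ℤ.∣ ℚ.↥ q ∣)) (bound q))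
  where
  bound : ∀ q → ℚ.toℚᵘ q ℚᵘ.≤ ℚᵘ.mkℚᵘ (+ ℤ.∣ ℚ.↥ q ∣) 0
  bound (mkℚ (+ m) d _) = ℚᵘ.*≤* (ℤ.*-monoˡ-≤-nonNeg (+ m) (ℤ.+≤+ (ℕ.s≤s ℕ.z≤n)))
  bound (mkℚ -[1+ m ] d _) = ℚᵘ.*≤* ℤ.-≤+

-- Bisection

-- A zero of `g` is recorded on the terms of the approximating sequence: `g` is nonnegative there
-- and tends to zero. So `g` need only be defined on rationals.
record Root (g : ℚ → ℚ) (a b : ℚ) : Set where
  field
    root   : ℝ
    lower  : ∀ i → a ℚ.≤ seq root i
    upper  : ∀ i → seq root i ℚ.≤ b
    nonneg : ∀ i → 0ℚ ℚ.≤ g (seq root i)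
    small  : ∀ δ → 0ℚ ℚ.< δ → ∃[ N ] (∀ i → N ≤ i → g (seq root i) ℚ.< δ)

-- Only a one-sided Lipschitz bound, on the decrease of g, is needed.
DecreaseBound : (ℚ → ℚ) → ℚ → ℚ → ℚ → Set
DecreaseBound g L a b = ∀ x y → a ℚ.≤ x → x ℚ.≤ y → y ℚ.≤ b →
  g x ℚ.≤ g y ℚ.+ L ℚ.* (y ℚ.- x)

module _ (g : ℚ → ℚ) (a b L : ℚ) (0<L : 0ℚ ℚ.< L) (lip : DecreaseBound g L a b) where

  private
    record Bracket : Set where
      field
        lo hi : ℚ
        a≤lo  : a ℚ.≤ lo
        lo≤hi : lo ℚ.≤ hi
        hi≤b  : hi ℚ.≤ b
        0≤g   : 0ℚ ℚ.≤ g lo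
        g≤0   : g hi ℚ.≤ 0ℚ

      mid : ℚ
      mid = ½ ℚ.* (lo ℚ.+ hi)

      0≤half-width : 0ℚ ℚ.≤ ½ ℚ.* (hi ℚ.- lo)
      0≤half-width = 0≤* (ℚ.<⇒≤ 0<½) (0≤difference lo≤hi)

      lo≤mid : lo ℚ.≤ mid
      lo≤mid = ≤-by _ 0≤half-width
        (solve 2 (λ l h → l :+ con ½ :* (h :- l) := con ½ :* (l :+ h)) refl lo hi)

      mid≤hi : mid ℚ.≤ hi
      mid≤hi = ≤-by _ 0≤half-width
        (solve 2 (λ l h → con ½ :* (l :+ h) :+ con ½ :* (h :- l) := h) refl lo hi)

      width : ℚ
      width = hi ℚ.- lo

    open Bracket

    record Halving (I J : Bracket) : Set where
      field
        lo≤   : lo I ℚ.≤ lo J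
        ≤hi   : hi J ℚ.≤ hi I
        half  : width J ≡ ½ ℚ.* width I

    open Halving

    halve : ∀ I → Σ Bracket (Halving I)
    -- The midpoint and its value are rational, so the sign can be decided.
    halve I with ℚ.≤-total 0ℚ (g (mid I))
    ... | inj₁ 0≤gm = record
        { lo = mid I ; hi = hi I ; a≤lo = ℚ.≤-trans (a≤lo I) (lo≤mid I)
        ; lo≤hi = mid≤hi I ; hi≤b = hi≤b I ; 0≤g = 0≤gm ; g≤0 = g≤0 I } ,
      record { lo≤ = lo≤mid I ; ≤hi = ℚ.≤-refl
             ; half = solve 2 (λ l h → h :- con ½ :* (l :+ h) := con ½ :* (h :- l)) refl (lo I) (hi I) }
    ... | inj₂ gm≤0 = record
        { lo = lo I ; hi = mid I ; a≤lo = a≤lo I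
        ; lo≤hi = lo≤mid I ; hi≤b = ℚ.≤-trans (mid≤hi I) (hi≤b I) ; 0≤g = 0≤g I ; g≤0 = gm≤0 } ,
      record { lo≤ = ℚ.≤-refl ; ≤hi = mid≤hi I
             ; half = solve 2 (λ l h → con ½ :* (l :+ h) :- l := con ½ :* (h :- l)) refl (lo I) (hi I) }

    module Bisection (I₀ : Bracket) where

      bracket : ℕ → Bracket
      bracket zero    = I₀
      bracket (suc k) = proj₁ (halve (bracket k))

      halving : ∀ k → Halving (bracket k) (bracket (suc k))
      halving k = proj₂ (halve (bracket k))

      nested : ∀ {i j} → i ℕ.≤′ j →
               lo (bracket i) ℚ.≤ lo (bracket j) × hi (bracket j) ℚ.≤ hi (bracket i)
      nested (ℕ.≤′-reflexive refl) = ℚ.≤-refl , ℚ.≤-refl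
      nested (ℕ.≤′-step {n = j} i≤j) =
        let p , q = nested i≤j in
        ℚ.≤-trans p (lo≤ (halving j)) , ℚ.≤-trans (≤hi (halving j)) q

      0≤width : ∀ k → 0ℚ ℚ.≤ width (bracket k)
      0≤width k = 0≤difference (lo≤hi (bracket k))

      -- The widths halve, but the harmonic rate `1 / (k + 1)` suffices and needs no powers of two.
      -- The induction rests on `(k + 2) / 2 ≤ k + 1`, with slack `k / 2`.
      width-decay : ∀ k → ι (suc k) ℚ.* width (bracket k) ℚ.≤ width I₀
      width-decay zero    = ℚ.≤-reflexive
        (trans (cong (ℚ._* width I₀) (ℚ.+-identityʳ 1ℚ)) (ℚ.*-identityˡ (width I₀)))
      width-decay (suc k) = ℚ.≤-trans (≤-by (½ ℚ.* (ι k ℚ.* w))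
          (0≤* (ℚ.<⇒≤ 0<½) (0≤* (0≤ι k) (0≤width k)))
          (trans (cong (λ v → ι (suc (suc k)) ℚ.* v ℚ.+ ½ ℚ.* (ι k ℚ.* w)) (half (halving k)))
            (solve 2 (λ i w → (con 1ℚ :+ (con 1ℚ :+ i)) :* (con ½ :* w) :+ con ½ :* (i :* w)
                           := (con 1ℚ :+ i) :* w) refl (ι k) w)))
        (width-decay k)
        where w = width (bracket k)

      width-small : ∀ δ → 0ℚ ℚ.< δ → ∃[ N ] (∀ i → N ≤ i → width (bracket i) ℚ.< δ)
      width-small δ 0<δ with divisible (1ℚ) 0<δ 0<1
      ... | r , 0<r , δr≡1 with archimedean (width I₀ ℚ.* r)
      -- Here `r = 1 / δ`. A width of at least `δ` at step `i` would give
      -- `i + 1 ≤ width I₀ * r ≤ N ≤ i`.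
      ... | N , w₀r≤N = N , λ i N≤i → ℚ.≰⇒> λ δ≤w → ℚ.<-irrefl refl (begin-strict
        ι i                                       <⟨ ι-mono-< (ℕ.n<1+n i) ⟩
        ι (suc i)                                 ≡⟨ sym (ℚ.*-identityʳ (ι (suc i))) ⟩
        ι (suc i) ℚ.* 1ℚ                          ≡⟨ cong (ι (suc i) ℚ.*_) (sym δr≡1) ⟩
        ι (suc i) ℚ.* (δ ℚ.* r)
          ≤⟨ ℚ.*-monoˡ-≤-nonNeg (ι (suc i)) {{ℚ.nonNegative (0≤ι (suc i))}}
               (ℚ.*-monoʳ-≤-nonNeg r {{ℚ.nonNegative (ℚ.<⇒≤ 0<r)}} δ≤w) ⟩
        ι (suc i) ℚ.* (width (bracket i) ℚ.* r)   ≡⟨ sym (ℚ.*-assoc (ι (suc i)) (width (bracket i)) r) ⟩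
        ι (suc i) ℚ.* width (bracket i) ℚ.* r
          ≤⟨ ℚ.*-monoʳ-≤-nonNeg r {{ℚ.nonNegative (ℚ.<⇒≤ 0<r)}} (width-decay i) ⟩
        width I₀ ℚ.* r                            ≤⟨ w₀r≤N ⟩
        ι N                                       ≤⟨ ι-mono-≤ N≤i ⟩
        ι i                                       ∎)
        where open ℚ.≤-Reasoning

      ordered-distance : ∀ {l u x y} → l ℚ.≤ x → x ℚ.≤ u → l ℚ.≤ y → y ℚ.≤ u →
                         ℚ.∣ x ℚ.- y ∣ ℚ.≤ u ℚ.- l
      ordered-distance {l} {u} {x} {y} l≤x x≤u l≤y y≤u with ℚ.∣p∣≡p∨∣p∣≡-p (x ℚ.- y)
      ... | inj₁ eq = ℚ.≤-trans (ℚ.≤-reflexive eq) (ℚ.+-mono-≤ x≤u (ℚ.neg-antimono-≤ l≤y))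
      ... | inj₂ eq = ℚ.≤-trans
        (ℚ.≤-reflexive (trans eq (solve 2 (λ x y → :- (x :- y) := y :- x) refl x y)))
        (ℚ.+-mono-≤ y≤u (ℚ.neg-antimono-≤ l≤x))

      -- From step `N` on, all left endpoints lie in bracket `N`, whose width is below `δ`.
      lo-cauchy : IsCauchy (λ k → lo (bracket k))
      lo-cauchy δ 0<δ =
        let N , small = width-small δ 0<δ in
        N , λ i j N≤i N≤j →
          let li , ui = nested (ℕ.≤⇒≤′ N≤i)
              lj , uj = nested (ℕ.≤⇒≤′ N≤j)
          in ℚ.≤-<-trans (ordered-distance li (ℚ.≤-trans (lo≤hi (bracket i)) ui)
                                           lj (ℚ.≤-trans (lo≤hi (bracket j)) uj))
                         (small N ℕ.≤-refl)

      -- Since `g` is nonpositive at `hi`, its value at `lo` is at most the possible decrease across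
      -- the bracket, `L` times the width.
      g-small : ∀ δ → 0ℚ ℚ.< δ → ∃[ N ] (∀ i → N ≤ i → g (lo (bracket i)) ℚ.< δ)
      g-small δ 0<δ with divisible δ 0<L 0<δ
      ... | η , 0<η , Lη≡δ =
        let N , small = width-small η 0<η in
        N , λ i N≤i → begin-strict
          g (lo (bracket i))
            ≤⟨ lip _ _ (a≤lo (bracket i)) (lo≤hi (bracket i)) (hi≤b (bracket i)) ⟩
          g (hi (bracket i)) ℚ.+ L ℚ.* width (bracket i)
            ≤⟨ ℚ.+-monoˡ-≤ _ (g≤0 (bracket i)) ⟩
          0ℚ ℚ.+ L ℚ.* width (bracket i)
            ≡⟨ ℚ.+-identityˡ _ ⟩
          L ℚ.* width (bracket i)
            <⟨ ℚ.*-monoʳ-<-pos L {{ℚ.positive 0<L}} (small i N≤i) ⟩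
          L ℚ.* η
            ≡⟨ Lη≡δ ⟩
          δ ∎
        where open ℚ.≤-Reasoning

  bisect : a ℚ.≤ b → 0ℚ ℚ.≤ g a → g b ℚ.≤ 0ℚ → Root g a b
  bisect a≤b 0≤ga gb≤0 = record
    { root   = mkℝ (λ k → lo (bracket k)) lo-cauchy
    ; lower  = λ i → a≤lo (bracket i)
    ; upper  = λ i → ℚ.≤-trans (lo≤hi (bracket i)) (hi≤b (bracket i))
    ; nonneg = λ i → 0≤g (bracket i)
    ; small  = g-small
    }
    where
    initial : Bracket
    initial = record
      { lo = a ; hi = b ; a≤lo = ℚ.≤-refl ; lo≤hi = a≤b ; hi≤b = ℚ.≤-refl
      ; 0≤g = 0≤ga ; g≤0 = gb≤0 }
    open Bisection initial

  -- δ = g a / 2L works, since g tends to 0 along the root.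
  root-gap : (r : Root g a b) → 0ℚ ℚ.< g a →
    ∃[ δ ] (0ℚ ℚ.< δ × ∃[ N ] (∀ i → N ≤ i → a ℚ.+ δ ℚ.≤ seq (Root.root r) i))
  root-gap r 0<ga with divisible (½ ℚ.* g a) 0<L (0<* 0<½ 0<ga)
  ... | δ , 0<δ , Lδ≡c =
    let N , small = Root.small r (½ ℚ.* g a) (0<* 0<½ 0<ga) in
    δ , 0<δ , N , λ i N≤i →
      let x = seq (Root.root r) i in
      ≤-by _ (0≤difference (ℚ.*-cancelˡ-≤-pos L {{ℚ.positive 0<L}} (begin
        L ℚ.* δ                        ≡⟨ Lδ≡c ⟩
        ½ ℚ.* g a                      ≤⟨ ≤-by _ (0≤+ (0≤difference (ℚ.<⇒≤ (small i N≤i)))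
                                              (0≤difference (lip a x ℚ.≤-refl (Root.lower r i) (Root.upper r i))))
                                            (solve 3 (λ c u w → con ½ :* c :+ ((con ½ :* c :- u) :+ (u :+ w :- c)) := w) refl
                                              (g a) (g x) (L ℚ.* (x ℚ.- a))) ⟩
        L ℚ.* (x ℚ.- a)                ∎)))
        (solve 3 (λ a δ x → a :+ δ :+ (x :- a :- δ) := x) refl a δ x)
    where open ℚ.≤-Reasoning

-- Random sets

-- The probability of P for a random subset that contains each element
-- independently with probability x.
𝔼 : ℚ → {P : Subset n → Set} → U.Decidable P → ℚ
𝔼 {zero}  x P? = if does (P? Vec.[]) then 1ℚ else 0ℚ
𝔼 {suc n} x P? = (1ℚ ℚ.- x) ℚ.* 𝔼 x (λ C → P? (outside Vec.∷ C))
             ℚ.+ x ℚ.* 𝔼 x (λ C → P? (inside Vec.∷ C))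

-- Node reliability as the probability that a random set is connected

open NodeReliability ℚ.+-*-rawRing using () renaming (nRel to nRelℚ)

private
  weight : ℚ → Subset n → ℚ
  weight {n} x C = x ^ℚ ∣ C ∣ ℚ.* (1ℚ ℚ.- x) ^ℚ (n ∸ ∣ C ∣)

  weight-outside : ∀ x (C : Subset n) → weight x (outside Vec.∷ C) ≡ (1ℚ ℚ.- x) ℚ.* weight x C
  weight-outside {n} x C = trans
    -- The bound `∣ C ∣ ≤ n` keeps the truncated subtraction exact, so the exponent of `1 - x` grows
    -- by one.
    (cong (λ k → x ^ℚ ∣ C ∣ ℚ.* (1ℚ ℚ.- x) ^ℚ k) (ℕ.+-∸-assoc 1 (∣p∣≤n C)))
    (solve 3 (λ a b c → a :* (b :* c) := b :* (a :* c)) refl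
      (x ^ℚ ∣ C ∣) (1ℚ ℚ.- x) ((1ℚ ℚ.- x) ^ℚ (n ∸ ∣ C ∣)))

  weight-inside : ∀ x (C : Subset n) → weight x (inside Vec.∷ C) ≡ x ℚ.* weight x C
  weight-inside {n} x C = ℚ.*-assoc x (x ^ℚ ∣ C ∣) _

  module _ {A : Set} where

    sumOver : {P : A → Set} → (A → ℚ) → U.Decidable P → List A → ℚ
    sumOver t P? xs = foldr ℚ._+_ 0ℚ (map t (filter P? xs))

    sumOver-++ : ∀ {P : A → Set} t (P? : U.Decidable P) xs ys →
                 sumOver t P? (xs ++ ys) ≡ sumOver t P? xs ℚ.+ sumOver t P? ys
    sumOver-++ t P? []       ys = sym (ℚ.+-identityˡ _)
    sumOver-++ t P? (x ∷ xs) ys with does (P? x)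
    ... | true  = trans (cong (t x ℚ.+_) (sumOver-++ t P? xs ys)) (sym (ℚ.+-assoc (t x) _ _))
    ... | false = sumOver-++ t P? xs ys

  sumOver-map : ∀ {A B : Set} {P : B → Set} t (P? : U.Decidable P) (s : A → ℚ) (g : A → B) c →
                (∀ x → t (g x) ≡ c ℚ.* s x) → ∀ xs →
                sumOver t P? (map g xs) ≡ c ℚ.* sumOver s (λ x → P? (g x)) xs
  sumOver-map t P? s g c eq []       = sym (ℚ.*-zeroʳ c)
  sumOver-map t P? s g c eq (x ∷ xs) with P? (g x)
  ... | yes _ = trans (cong₂ ℚ._+_ (eq x) (sumOver-map t P? s g c eq xs)) (sym (ℚ.*-distribˡ-+ c _ _))
  ... | no  _ = sumOver-map t P? s g c eq xs

  sumOver-allSubsets : ∀ x {P : Subset n → Set} (P? : U.Decidable P) →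
                       sumOver (weight x) P? (allSubsets n) ≡ 𝔼 x P?
  sumOver-allSubsets {zero} x P? with P? Vec.[]
  ... | yes _ = refl
  ... | no  _ = refl
  sumOver-allSubsets {suc n} x P? = trans
    (sumOver-++ (weight x) P? (map (outside Vec.∷_) (allSubsets n)) _)
    (cong₂ ℚ._+_
      (trans (sumOver-map (weight x) P? (weight x) _ (1ℚ ℚ.- x) (weight-outside x) (allSubsets n))
        (cong ((1ℚ ℚ.- x) ℚ.*_) (sumOver-allSubsets x (λ C → P? (outside Vec.∷ C)))))
      (trans (sumOver-map (weight x) P? (weight x) _ x (weight-inside x) (allSubsets n))
        (cong (x ℚ.*_) (sumOver-allSubsets x (λ C → P? (inside Vec.∷ C))))))

nRelℚ-𝔼 : ∀ (G : Graph n) x → nRelℚ G x ≡ 𝔼 x (connectedSet? G)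
nRelℚ-𝔼 G x = sumOver-allSubsets x (connectedSet? G)

module _ {r ℓ} (R : RawRing r ℓ) {s ℓ′} (S : RawRing s ℓ′) where

  private
    module R where
      open RawRing R public
      open RawSemiring rawSemiring public using (_^_)
      open NodeReliability R public
    module S where
      open RawRing S public
      open RawSemiring rawSemiring public using (_^_)
      open NodeReliability S public

  -- Applied to the maps sending a real to its `i`-th term, which preserve the operations
  -- definitionally. The reliability at a real can thus be computed term by term over the rationals.
  nRel-homo : ∀ (h : R.Carrier → S.Carrier) → h R.0# ≡ S.0# → h R.1# ≡ S.1# →
    (∀ x y → h (x R.+ y) ≡ h x S.+ h y) → (∀ x y → h (x R.* y) ≡ h x S.* h y) →
    (∀ x → h (R.- x) ≡ S.- h x) →
    ∀ (G : Graph n) p → h (R.nRel G p) ≡ S.nRel G (h p)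
  nRel-homo {n} h 0-homo 1-homo +-homo *-homo neg-homo G p = sum-homo (connectedSets G)
    where
    ^-homo : ∀ x k → h (x R.^ k) ≡ h x S.^ k
    ^-homo x zero    = 1-homo
    ^-homo x (suc k) = trans (*-homo x _) (cong (h x S.*_) (^-homo x k))

    1-p-homo : h (R.1# R.+ R.- p) ≡ S.1# S.+ S.- h p
    1-p-homo = trans (+-homo R.1# _) (cong₂ S._+_ 1-homo (neg-homo p))

    term-homo : ∀ C → h (p R.^ ∣ C ∣ R.* (R.1# R.+ R.- p) R.^ (n ∸ ∣ C ∣))
                    ≡ h p S.^ ∣ C ∣ S.* (S.1# S.+ S.- h p) S.^ (n ∸ ∣ C ∣)
    term-homo C = trans (*-homo _ _) (cong₂ S._*_ (^-homo p ∣ C ∣)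
      (trans (^-homo _ (n ∸ ∣ C ∣)) (cong (S._^ (n ∸ ∣ C ∣)) 1-p-homo)))

    sum-homo : ∀ Cs →
      h (foldr R._+_ R.0# (map (λ C → p R.^ ∣ C ∣ R.* (R.1# R.+ R.- p) R.^ (n ∸ ∣ C ∣)) Cs))
      ≡ foldr S._+_ S.0# (map (λ C → h p S.^ ∣ C ∣ S.* (S.1# S.+ S.- h p) S.^ (n ∸ ∣ C ∣)) Cs)
    sum-homo []       = 0-homo
    sum-homo (C ∷ Cs) = trans (+-homo _ _) (cong₂ S._+_ (term-homo C) (sum-homo Cs))

seq-nRelℝ : ∀ (G : Graph n) x i → seq (nRelℝ G x) i ≡ 𝔼 (seq x i) (connectedSet? G)
seq-nRelℝ G x i = trans
  (nRel-homo ℝ-rawRing ℚ.+-*-rawRing (λ y → seq y i) refl refl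
    (λ _ _ → refl) (λ _ _ → refl) (λ _ → refl) G x)
  (nRelℚ-𝔼 G (seq x i))

-- Lower bounds for use near 0 and near 1

module _ {x : ℚ} (0≤x : 0ℚ ℚ.≤ x) (x≤1 : x ℚ.≤ 1ℚ) where

  private
    0≤1-x : 0ℚ ℚ.≤ 1ℚ ℚ.- x
    0≤1-x = 0≤difference x≤1

  0≤𝔼 : (P? : U.Decidable P) → 0ℚ ℚ.≤ 𝔼 x P?
  0≤𝔼 {zero} P? with does (P? Vec.[])
  ... | true  = ℚ.<⇒≤ 0<1
  ... | false = ℚ.≤-refl
  0≤𝔼 {suc n} P? = 0≤+
    (0≤* 0≤1-x (0≤𝔼 (λ C → P? (outside Vec.∷ C))))
    (0≤* 0≤x (0≤𝔼 (λ C → P? (inside Vec.∷ C))))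

  𝔼≤1 : (P? : U.Decidable P) → 𝔼 x P? ℚ.≤ 1ℚ
  𝔼≤1 {zero} P? with P? Vec.[]
  ... | yes _ = ℚ.≤-refl
  ... | no  _ = ℚ.<⇒≤ 0<1
  𝔼≤1 {suc n} P? = ≤-by _
    (0≤+ (0≤* 0≤1-x (0≤difference (𝔼≤1 (λ C → P? (outside Vec.∷ C)))))
         (0≤* 0≤x   (0≤difference (𝔼≤1 (λ C → P? (inside Vec.∷ C))))))
    (solve 3 (λ x a b → (con 1ℚ :- x) :* a :+ x :* b
                     :+ ((con 1ℚ :- x) :* (con 1ℚ :- a) :+ x :* (con 1ℚ :- b)) := con 1ℚ)
      refl x _ _)

  -- The empty set alone has probability `(1 - x)^n`; this is Bernoulli's inequality.
  𝔼-empty-≥ : (P? : U.Decidable P) → (∀ C → ∣ C ∣ ≡ 0 → P C) →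
              1ℚ ℚ.- ι n ℚ.* x ℚ.≤ 𝔼 {n} x P?
  𝔼-empty-≥ {n = zero} P? h with P? Vec.[]
  ... | yes _ = ℚ.≤-reflexive (solve 1 (λ x → con 1ℚ :- con 0ℚ :* x := con 1ℚ) refl x)
  ... | no ¬p = contradiction (h Vec.[] refl) ¬p
  𝔼-empty-≥ {n = suc n} P? h = ≤-by _
    (0≤+ (0≤* 0≤1-x (0≤difference (𝔼-empty-≥ {n = n} (λ C → P? (outside Vec.∷ C)) (λ C → h (outside Vec.∷ C)))))
    (0≤+ (0≤* (0≤ι n) (0≤* 0≤x 0≤x)) (0≤* 0≤x (0≤𝔼 (λ C → P? (inside Vec.∷ C))))))
    (solve 4 (λ x n a b → con 1ℚ :- (con 1ℚ :+ n) :* x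
        :+ ((con 1ℚ :- x) :* (a :- (con 1ℚ :- n :* x)) :+ (n :* (x :* x) :+ x :* b))
        := (con 1ℚ :- x) :* a :+ x :* b)
      refl x (ι n) _ _)

  -- Split on the first element: if it is out, the rest should be a singleton; if it is in, the rest
  -- should be empty. With `n + 1` elements, the two bounds combined exceed the claim by
  -- `x² + n²x³`.
  𝔼-singleton-≥ : (P? : U.Decidable P) → (∀ C → ∣ C ∣ ≡ 1 → P C) →
                  ι n ℚ.* x ℚ.* (1ℚ ℚ.- ι n ℚ.* x) ℚ.≤ 𝔼 {n} x P?
  𝔼-singleton-≥ {n = zero} P? h = ℚ.≤-trans
    (ℚ.≤-reflexive (solve 1 (λ x → con 0ℚ :* x :* (con 1ℚ :- con 0ℚ :* x) := con 0ℚ) refl x))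
    (0≤𝔼 P?)
  𝔼-singleton-≥ {n = suc n} P? h = ≤-by _
    (0≤+ (0≤* 0≤1-x (0≤difference (𝔼-singleton-≥ {n = n} (λ C → P? (outside Vec.∷ C)) (λ C → h (outside Vec.∷ C)))))
    (0≤+ (0≤* 0≤x (0≤difference (𝔼-empty-≥ {n = n} (λ C → P? (inside Vec.∷ C)) (λ C → h (inside Vec.∷ C) ∘ cong suc))))
         (0≤+ (0≤* 0≤x 0≤x) (0≤* (0≤* (0≤* nn nn) (0≤* 0≤x 0≤x)) 0≤x))))
    (solve 4 (λ x n a b → (con 1ℚ :+ n) :* x :* (con 1ℚ :- (con 1ℚ :+ n) :* x)
        :+ ((con 1ℚ :- x) :* (a :- n :* x :* (con 1ℚ :- n :* x))
            :+ (x :* (b :- (con 1ℚ :- n :* x)) :+ (x :* x :+ n :* n :* (x :* x) :* x)))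
        := (con 1ℚ :- x) :* a :+ x :* b)
      refl x (ι n) _ _)
    where nn = 0≤ι n

  -- Bernoulli's inequality again, now for the full set and in `1 - x`.
  𝔼-full-≥ : (P? : U.Decidable P) → (∀ C → n ≤ ∣ C ∣ → P C) →
             1ℚ ℚ.- ι n ℚ.* (1ℚ ℚ.- x) ℚ.≤ 𝔼 {n} x P?
  𝔼-full-≥ {n = zero} P? h with P? Vec.[]
  ... | yes _ = ℚ.≤-reflexive (solve 1 (λ x → con 1ℚ :- con 0ℚ :* (con 1ℚ :- x) := con 1ℚ) refl x)
  ... | no ¬p = contradiction (h Vec.[] ℕ.≤-refl) ¬p
  𝔼-full-≥ {n = suc n} P? h = ≤-by _
    (0≤+ (0≤* 0≤x (0≤difference (𝔼-full-≥ {n = n} (λ C → P? (inside Vec.∷ C)) (λ C → h (inside Vec.∷ C) ∘ ℕ.s≤s))))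
    (0≤+ (0≤* (0≤ι n) (0≤* 0≤1-x 0≤1-x)) (0≤* 0≤1-x (0≤𝔼 (λ C → P? (outside Vec.∷ C))))))
    (solve 4 (λ x n a b → con 1ℚ :- (con 1ℚ :+ n) :* (con 1ℚ :- x)
        :+ (x :* (b :- (con 1ℚ :- n :* (con 1ℚ :- x)))
            :+ (n :* ((con 1ℚ :- x) :* (con 1ℚ :- x)) :+ (con 1ℚ :- x) :* a))
        := (con 1ℚ :- x) :* a :+ x :* b)
      refl x (ι n) _ _)

  -- Split on the first element: if it is missing, the rest should be full; otherwise the rest may
  -- miss one. Writing `y = 1 - x`, the step from `n` to `n + 1` leaves the slack
  -- `y² + n y² + n² y³`.
  𝔼-co-singleton-≥ : (P? : U.Decidable P) → (∀ C → n ≤ suc ∣ C ∣ → P C) →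
    1ℚ ℚ.- ι n ℚ.* (1ℚ ℚ.- x) ℚ.* (ι n ℚ.* (1ℚ ℚ.- x)) ℚ.≤ 𝔼 {n} x P?
  𝔼-co-singleton-≥ {n = zero} P? h with P? Vec.[]
  ... | yes _ = ℚ.≤-reflexive (solve 1 (λ x → con 1ℚ :- con 0ℚ :* (con 1ℚ :- x) :* (con 0ℚ :* (con 1ℚ :- x)) := con 1ℚ)
      refl x)
  ... | no ¬p = contradiction (h Vec.[] ℕ.z≤n) ¬p
  𝔼-co-singleton-≥ {n = suc n} P? h = ≤-by _
    (0≤+ (0≤* 0≤1-x (0≤difference (𝔼-full-≥ {n = n} (λ C → P? (outside Vec.∷ C)) (λ C → h (outside Vec.∷ C) ∘ ℕ.s≤s))))
    (0≤+ (0≤* 0≤x (0≤difference (𝔼-co-singleton-≥ {n = n} (λ C → P? (inside Vec.∷ C)) (λ C → h (inside Vec.∷ C) ∘ ℕ.s≤s))))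
         (0≤+ (0≤* 0≤1-x 0≤1-x) (0≤+ (0≤* (0≤ι n) (0≤* 0≤1-x 0≤1-x))
              (0≤* (0≤* (0≤* nn nn) (0≤* 0≤1-x 0≤1-x)) 0≤1-x)))))
    (solve 4 (λ x n a b → let y = con 1ℚ :- x in
        con 1ℚ :- (con 1ℚ :+ n) :* y :* ((con 1ℚ :+ n) :* y)
        :+ (y :* (a :- (con 1ℚ :- n :* y))
            :+ (x :* (b :- (con 1ℚ :- n :* y :* (n :* y)))
            :+ (y :* y :+ (n :* (y :* y) :+ n :* n :* (y :* y) :* y))))
        := y :* a :+ x :* b)
      refl x (ι n) _ _)
    where nn = 0≤ι n

-- Lipschitz bounds in the probability

module _ {x y : ℚ} (0≤x : 0ℚ ℚ.≤ x) (x≤y : x ℚ.≤ y) (y≤1 : y ℚ.≤ 1ℚ) where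

  private
    0≤y = ℚ.≤-trans 0≤x x≤y
    x≤1 = ℚ.≤-trans x≤y y≤1

    0≤1-x : 0ℚ ℚ.≤ 1ℚ ℚ.- x
    0≤1-x = 0≤difference x≤1

    reflexive-bound : ∀ a → a ℚ.≤ a ℚ.+ ι 0 ℚ.* (y ℚ.- x)
    reflexive-bound a = ℚ.≤-reflexive (solve 2 (λ a d → a := a :+ con 0ℚ :* d) refl a (y ℚ.- x))

  -- Raising the probability of one coordinate moves mass `y - x` between two conditional
  -- probabilities, both in the unit interval, which costs at most `y - x`. The `n` coordinates add
  -- up.
  𝔼-decrease : (P? : U.Decidable P) → 𝔼 {n} x P? ℚ.≤ 𝔼 y P? ℚ.+ ι n ℚ.* (y ℚ.- x)
  𝔼-decrease {n = zero} P? = reflexive-bound (𝔼 x P?)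
  𝔼-decrease {n = suc n} P? = ≤-by _
    (0≤+ (0≤* 0≤1-x (0≤difference (𝔼-decrease {n = n} out?)))
    (0≤+ (0≤* 0≤x (0≤difference (𝔼-decrease {n = n} in?)))
         (0≤* (0≤difference x≤y)
              (0≤+ (0≤difference (𝔼≤1 0≤y y≤1 out?)) (0≤𝔼 0≤y y≤1 in?)))))
    (solve 7 (λ x y n a b a′ b′ → (con 1ℚ :- x) :* a :+ x :* b
         :+ ((con 1ℚ :- x) :* (a′ :+ n :* (y :- x) :- a)
         :+ (x :* (b′ :+ n :* (y :- x) :- b)
         :+ (y :- x) :* ((con 1ℚ :- a′) :+ b′)))
         := (con 1ℚ :- y) :* a′ :+ y :* b′ :+ (con 1ℚ :+ n) :* (y :- x))
      refl x y (ι n) (𝔼 x out?) (𝔼 x in?) (𝔼 y out?) (𝔼 y in?))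
    where
    out? = λ C → P? (outside Vec.∷ C)
    in?  = λ C → P? (inside Vec.∷ C)

  𝔼-increase : (P? : U.Decidable P) → 𝔼 {n} y P? ℚ.≤ 𝔼 x P? ℚ.+ ι n ℚ.* (y ℚ.- x)
  𝔼-increase {n = zero} P? = reflexive-bound (𝔼 x P?)
  𝔼-increase {n = suc n} P? = ≤-by _
    (0≤+ (0≤* 0≤1-x (0≤difference (𝔼-increase {n = n} out?)))
    (0≤+ (0≤* 0≤x (0≤difference (𝔼-increase {n = n} in?)))
         (0≤* (0≤difference x≤y)
              (0≤+ (0≤difference (𝔼≤1 0≤y y≤1 in?)) (0≤𝔼 0≤y y≤1 out?)))))
    (solve 7 (λ x y n a b a′ b′ → (con 1ℚ :- y) :* a′ :+ y :* b′
         :+ ((con 1ℚ :- x) :* (a :+ n :* (y :- x) :- a′)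
         :+ (x :* (b :+ n :* (y :- x) :- b′)
         :+ (y :- x) :* ((con 1ℚ :- b′) :+ a′)))
         := (con 1ℚ :- x) :* a :+ x :* b :+ (con 1ℚ :+ n) :* (y :- x))
      refl x y (ι n) (𝔼 x out?) (𝔼 x in?) (𝔼 y out?) (𝔼 y in?))
    where
    out? = λ C → P? (outside Vec.∷ C)
    in?  = λ C → P? (inside Vec.∷ C)

-- The two fixed points

-- At `½` all `2 ^ n` sets are equally likely.
count-𝔼 : (P? : U.Decidable P) → 𝔼 {n} ½ P? ℚ.* ι (2 ^ n) ≡ ι (count P?)
count-𝔼 {n = zero} P? with P? Vec.[]
... | yes _ = refl
... | no _  = refl
count-𝔼 {n = suc n} P? = begin
  (½ ℚ.* a ℚ.+ ½ ℚ.* b) ℚ.* ι (2 ^ suc n)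
    ≡⟨ cong ((½ ℚ.* a ℚ.+ ½ ℚ.* b) ℚ.*_)
         (trans (ι-homo-+ (2 ^ n) (2 ^ n ℕ.+ 0)) (cong (ι (2 ^ n) ℚ.+_) (ι-homo-+ (2 ^ n) 0))) ⟩
  (½ ℚ.* a ℚ.+ ½ ℚ.* b) ℚ.* (ι (2 ^ n) ℚ.+ (ι (2 ^ n) ℚ.+ 0ℚ))
    ≡⟨ solve 3 (λ a b t → (con ½ :* a :+ con ½ :* b) :* (t :+ (t :+ con 0ℚ)) := a :* t :+ b :* t) refl a b (ι (2 ^ n)) ⟩
  a ℚ.* ι (2 ^ n) ℚ.+ b ℚ.* ι (2 ^ n)
    ≡⟨ cong₂ ℚ._+_ (count-𝔼 {n = n} out?) (count-𝔼 {n = n} in?) ⟩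
  ι (count out?) ℚ.+ ι (count in?)
    ≡⟨ sym (ι-homo-+ (count out?) (count in?)) ⟩
  ι (count P?) ∎
  where
  open ≡-Reasoning
  out? = λ C → P? (outside Vec.∷ C)
  in?  = λ C → P? (inside Vec.∷ C)
  a = 𝔼 ½ out?
  b = 𝔼 ½ in?

minority⇒𝔼<½ : (P? : U.Decidable P) → 2 ℕ.* count P? < 2 ^ n → 𝔼 {n} ½ P? ℚ.< ½
minority⇒𝔼<½ {n = n} P? few = ℚ.≰⇒> λ ½≤E → ℚ.<-irrefl refl (begin-strict
  ι (2 ℕ.* count P?)
    <⟨ ι-mono-< few ⟩
  T
    ≡⟨ solve 1 (λ t → t := con ½ :* t :+ con ½ :* t) refl T ⟩
  ½ ℚ.* T ℚ.+ ½ ℚ.* T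
    ≤⟨ ℚ.+-mono-≤ (scale ½≤E) (scale ½≤E) ⟩
  𝔼 ½ P? ℚ.* T ℚ.+ 𝔼 ½ P? ℚ.* T
    ≡⟨ cong₂ ℚ._+_ (count-𝔼 P?) (trans (count-𝔼 P?) (cong ι (sym (ℕ.+-identityʳ (count P?))))) ⟩
  ι (count P?) ℚ.+ ι (count P? ℕ.+ 0)
    ≡⟨ sym (ι-homo-+ (count P?) (count P? ℕ.+ 0)) ⟩
  ι (2 ℕ.* count P?) ∎)
  where
  open ℚ.≤-Reasoning
  T = ι (2 ^ n)
  scale : ∀ {a b} → a ℚ.≤ b → a ℚ.* T ℚ.≤ b ℚ.* T
  scale = ℚ.*-monoʳ-≤-nonNeg T {{ℚ.nonNegative (0≤ι (2 ^ n))}}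

module _ (G : Graph n) (conn : KConnected 2 G) (large : threshold (maxDegree G) ≤ n) where

  private
    -- `bisect` expects a passage from nonnegative to nonpositive values. Left of `½` this is made
    -- by `g`, right of `½` by its negative `h`.
    f g h : ℚ → ℚ
    f x = 𝔼 x (connectedSet? G)
    g x = f x ℚ.- x
    h x = x ℚ.- f x

    -- `f` has Lipschitz constant `N`, and the identity adds one more; `L` serves both `g` and `h`.
    N L : ℚ
    N = ι n
    L = ι (suc n)

    1≤N : 1ℚ ℚ.≤ N
    1≤N = ι-mono-≤ {1} (ℕ.≤-trans (ℕ.n≤1+n 1) (ℕ.<⇒≤ (proj₁ conn)))

    0≤N-2 : 0ℚ ℚ.≤ N ℚ.- (1ℚ ℚ.+ 1ℚ)
    0≤N-2 = 0≤difference (ι-mono-≤ {2} (ℕ.<⇒≤ (proj₁ conn)))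

    1+N² : ℚ
    1+N² = 1ℚ ℚ.+ N ℚ.* N

    -- The choice `η = 1 / (1 + N²)` makes `N²η² = η - η²`, which settles the estimates at both `η`
    -- and `1 - η`.
    η-exists : ∃[ η ] (0ℚ ℚ.< η × 1+N² ℚ.* η ≡ 1ℚ)
    η-exists = divisible 1ℚ (ℚ.+-mono-<-≤ 0<1 (0≤* (0≤ι n) (0≤ι n))) 0<1

    η : ℚ
    η = proj₁ η-exists

    0<η : 0ℚ ℚ.< η
    0<η = proj₁ (proj₂ η-exists)

    0≤η = ℚ.<⇒≤ 0<η

    1+N²η≡1 : 1+N² ℚ.* η ≡ 1ℚ
    1+N²η≡1 = proj₂ (proj₂ η-exists)

    η≤½ : η ℚ.≤ ½
    η≤½ = ≤-by _ (0≤* (ℚ.<⇒≤ 0<½) (0≤* (0≤* (0≤difference 1≤N) (0≤+ (ℚ.<⇒≤ 0<1) (0≤ι n))) 0≤η))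
      (trans (solve 2 (λ N e → e :+ con ½ :* ((N :- con 1ℚ) :* (con 1ℚ :+ N) :* e)
                            := con ½ :* ((con 1ℚ :+ N :* N) :* e)) refl N η)
             (trans (cong (½ ℚ.*_) 1+N²η≡1) (ℚ.*-identityʳ ½)))

    ½≤1-η : ½ ℚ.≤ 1ℚ ℚ.- η
    ½≤1-η = ≤-by _ (0≤difference η≤½)
      (solve 1 (λ e → con ½ :+ (con ½ :- e) := con 1ℚ :- e) refl η)

    ½≤1 : ½ ℚ.≤ 1ℚ
    ½≤1 = ≤-by ½ (ℚ.<⇒≤ 0<½) refl

    0≤½ = ℚ.<⇒≤ 0<½

    1-η<1 : 1ℚ ℚ.- η ℚ.< 1ℚ
    1-η<1 = <-by η 0<η (solve 1 (λ e → con 1ℚ :- e :+ e := con 1ℚ) refl η)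

    1-η≤1 = ℚ.<⇒≤ 1-η<1
    0≤1-η = ℚ.≤-trans 0≤½ ½≤1-η
    η≤1 = ℚ.≤-trans η≤½ ½≤1

    -- The singletons give `f η ≥ Nη (1 - Nη) = Nη - η + η²`, which is at least `η` because `N ≥ 2`.
    0≤gη : 0ℚ ℚ.≤ g η
    0≤gη = 0≤difference (ℚ.≤-trans
      (≤-by _ (0≤+ (0≤* 0≤N-2 0≤η) (0≤* 0≤η 0≤η))
        (trans (solve 2 (λ N e → e :+ ((N :- (con 1ℚ :+ con 1ℚ)) :* e :+ e :* e)
                              := N :* e :- con 1ℚ :* e :+ e :* e) refl N η)
        -- Replacing the coefficient 1 of `η` by `(1 + N²) η` is what trades `η` for `η² + N²η²`.
        (trans (cong (λ t → N ℚ.* η ℚ.- t ℚ.* η ℚ.+ η ℚ.* η) (sym 1+N²η≡1))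
          (solve 2 (λ N e → N :* e :- (con 1ℚ :+ N :* N) :* e :* e :+ e :* e
                         := N :* e :* (con 1ℚ :- N :* e)) refl N η))))
      (𝔼-singleton-≥ 0≤η η≤1 (connectedSet? G) (singleton-connected G)))

    -- The sets missing at most one vertex give `f (1 - η) ≥ 1 - N²η² = 1 - η + η²`.
    h1-η≤0 : h (1ℚ ℚ.- η) ℚ.≤ 0ℚ
    h1-η≤0 = ≤-by _ (0≤difference (ℚ.≤-trans
      (≤-by _ (0≤* 0≤η 0≤η)
        (trans (solve 1 (λ e → con 1ℚ :- e :+ e :* e := con 1ℚ :- con 1ℚ :* e :+ e :* e) refl η)
        (trans (cong (λ t → 1ℚ ℚ.- t ℚ.* η ℚ.+ η ℚ.* η) (sym 1+N²η≡1))
          (solve 2 (λ N e → let d = con 1ℚ :- (con 1ℚ :- e) in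
              con 1ℚ :- (con 1ℚ :+ N :* N) :* e :* e :+ e :* e
              := con 1ℚ :- N :* d :* (N :* d)) refl N η))))
      (𝔼-co-singleton-≥ 0≤1-η 1-η≤1 (connectedSet? G) (co-singleton-connected G conn))))
      (solve 2 (λ x y → x :- y :+ (y :- x) := con 0ℚ) refl (1ℚ ℚ.- η) (f (1ℚ ℚ.- η)))

    f½<½ : f ½ ℚ.< ½
    f½<½ = minority⇒𝔼<½ (connectedSet? G) (few-connected G large)

    0<h½ : 0ℚ ℚ.< h ½
    0<h½ = 0<difference f½<½

    g½≤0 : g ½ ℚ.≤ 0ℚ
    g½≤0 = ≤-by _ (ℚ.<⇒≤ 0<h½) (solve 1 (λ y → y :- con ½ :+ (con ½ :- y) := con 0ℚ) refl (f ½))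

    g-decrease : DecreaseBound g L η ½
    g-decrease x y η≤x x≤y y≤½ = ≤-by _
      (0≤difference (𝔼-decrease (ℚ.≤-trans 0≤η η≤x) x≤y (ℚ.≤-trans y≤½ ½≤1) (connectedSet? G)))
      (solve 5 (λ x y N a b → a :- x :+ (b :+ N :* (y :- x) :- a)
                           := b :- y :+ (con 1ℚ :+ N) :* (y :- x)) refl x y N (f x) (f y))

    h-decrease : DecreaseBound h L ½ (1ℚ ℚ.- η)
    h-decrease x y ½≤x x≤y y≤1-η = ≤-by _
      (0≤+ (0≤difference (𝔼-increase (ℚ.≤-trans 0≤½ ½≤x) x≤y (ℚ.≤-trans y≤1-η 1-η≤1) (connectedSet? G)))
           -- The actual decrease of `h` is at most `(N - 1) (y - x)`; two copies of `y - x` fill up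
           -- to `L`.
           (0≤+ (0≤difference x≤y) (0≤difference x≤y)))
      (solve 5 (λ x y N a b → x :- a :+ (a :+ N :* (y :- x) :- b :+ ((y :- x) :+ (y :- x)))
                           := y :- b :+ (con 1ℚ :+ N) :* (y :- x)) refl x y N (f x) (f y))

    -- By `seq-nRelℝ` each term of `nRelℝ G p` is `f` at the corresponding term of `p`, so the
    -- equation says that `g` tends to zero along `p`.
    fixedPoint : ∀ p → (∀ δ → 0ℚ ℚ.< δ → ∃[ M ] (∀ i → M ≤ i → ℚ.∣ g (seq p i) ∣ ℚ.< δ)) →
                 FixedPoint G p
    fixedPoint p small δ 0<δ =
      let M , bound = small δ 0<δ in
      M , λ i M≤i → subst (λ y → ℚ.∣ y ℚ.- seq p i ∣ ℚ.< δ) (sym (seq-nRelℝ G p i)) (bound i M≤i)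

    ∣g∣≡h : ∀ x → 0ℚ ℚ.≤ h x → ℚ.∣ g x ∣ ≡ h x
    ∣g∣≡h x 0≤hx = trans (cong ℚ.∣_∣ (solve 2 (λ x y → y :- x := :- (x :- y)) refl x (f x)))
      (trans (ℚ.∣-p∣≡∣p∣ (h x)) (ℚ.0≤p⇒∣p∣≡p 0≤hx))

    g-root-fixed : ∀ {a b} (r : Root g a b) → FixedPoint G (Root.root r)
    g-root-fixed r = fixedPoint (Root.root r) λ δ 0<δ →
      let M , small = Root.small r δ 0<δ in
      M , λ i M≤i → subst (ℚ._< δ) (sym (ℚ.0≤p⇒∣p∣≡p (Root.nonneg r i))) (small i M≤i)

    h-root-fixed : ∀ {a b} (r : Root h a b) → FixedPoint G (Root.root r)
    h-root-fixed r = fixedPoint (Root.root r) λ δ 0<δ →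
      let M , small = Root.small r δ 0<δ in
      M , λ i M≤i → subst (ℚ._< δ) (sym (∣g∣≡h (seq (Root.root r) i) (Root.nonneg r i))) (small i M≤i)

    inUnitInterval : ∀ {φ a b} → 0ℚ ℚ.< a → b ℚ.< 1ℚ → (r : Root φ a b) → InUnitInterval (Root.root r)
    inUnitInterval {a = a} {b} 0<a b<1 r =
      (a , 0<a , 0 , λ i _ → ℚ.≤-trans (ℚ.≤-reflexive (ℚ.+-identityˡ a)) (Root.lower r i)) ,
      (1ℚ ℚ.- b , 0<difference b<1 , 0 , λ i _ →
        ℚ.≤-trans (ℚ.+-monoˡ-≤ _ (Root.upper r i)) (ℚ.≤-reflexive (add-difference b 1ℚ)))

    -- All terms of the left root are at most `½`. The strict inequality `0 < h ½` keeps the right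
    -- root eventually a fixed distance above `½`.
    distinct : (l : Root g η ½) (r : Root h ½ (1ℚ ℚ.- η)) → Root.root l #ℝ Root.root r
    distinct l r =
      let δ , 0<δ , M , gap = root-gap h ½ (1ℚ ℚ.- η) L (0<ι n) h-decrease r 0<h½ in
      inj₁ (δ , 0<δ , M , λ i M≤i → ℚ.≤-trans (ℚ.+-monoˡ-≤ δ (Root.upper l i)) (gap i M≤i))

    root-pair : Root g η ½ → Root h ½ (1ℚ ℚ.- η) → ∃[ p ] ∃[ q ] (p #ℝ q ×
      (InUnitInterval p × FixedPoint G p) × (InUnitInterval q × FixedPoint G q))
    root-pair l r = Root.root l , Root.root r , distinct l r ,
      (inUnitInterval 0<η (ℚ.≤-<-trans ½≤1-η 1-η<1) l , g-root-fixed l) ,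
      (inUnitInterval 0<½ 1-η<1 r , h-root-fixed r)

  two-fixed-points : ∃[ p ] ∃[ q ] (p #ℝ q ×
    (InUnitInterval p × FixedPoint G p) × (InUnitInterval q × FixedPoint G q))
  two-fixed-points = root-pair
    (bisect g η ½ L (0<ι n) g-decrease η≤½ 0≤gη g½≤0)
    (bisect h ½ (1ℚ ℚ.- η) L (0<ι n) h-decrease ½≤1-η (ℚ.<⇒≤ 0<h½) h1-η≤0)

theorem4p3 : ∀ (Δ : ℕ) → 2 ≤ Δ →
    ∃[ N ] (∀ (n : ℕ) → N ≤ n → (G : Graph n) →
    KConnected 2 G → maxDegree G ≡ Δ →
    ∃[ p ] ∃[ q ] (p #ℝ q ×
    (InUnitInterval p × FixedPoint G p) ×
    (InUnitInterval q × FixedPoint G q)))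
theorem4p3 Δ _ = threshold Δ , λ { n large G conn refl → two-fixed-points G conn large }
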